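{- Let $G$ be a finite simple graph with $n$ vertices and minimum degree $\delta > 1$. Let $\widehat{\delta} = \lfloor 0.5\,\delta \rfloor$, let $\delta' = \delta$ if $\delta$ is odd and $\delta' = \delta+1$ if $\delta$ is even, and let $\widetilde{d}_{0.5} = \binom{\delta'+1}{\lceil 0.5\,\delta' \rceil}$. Then $$\gamma_s(G) \le \left(1 - \frac{2\widehat{\delta}}{(1+\widehat{\delta})^{1+1/\widehat{\delta}}\,\widetilde{d}_{0.5}^{\;1/\widehat{\delta}}}\right) n.$$
   Context: For a vertex $v$ of $G$, $N[v]$ denotes the closed neighbourhood of $v$ (i.e. $v$ together with its neighbours). A signed domination function of $G$ is a function $f: V(G) \to \{ -1, 1\}$ such that $\sum_{x \in N[v]} f(x) \ge 1$ for every vertex $v \in V(G)$. The weight of $f$ is $f(V(G)) = \sum_{v \in V(G)} f(v)$. The signed domination number $\gamma_s(G)$ is the minimum weight of a signed domination function of $G$. -}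

module Defs where

open import Data.Bool using (if_then_else_)
open import Level using (0ℓ)
open import Data.Empty using (⊥-elim)
open import Data.Product using (∃; ∃-syntax; _×_; _,_; proj₁; proj₂)
open import Data.Sum using (_⊎_; inj₁; inj₂)
open import Relation.Nullary using (Dec; yes; no; does)
open import Relation.Binary.PropositionalEquality
  using (_≡_; refl; sym; trans; cong; cong₂; subst)
open import Relation.Binary.Core using (Rel)
open import Relation.Binary.Definitions using (Decidable; Irreflexive; Symmetric)
open import Relation.Nullary.Decidable using (_⊎-dec_)
open import Data.Fin using (Fin)
import Data.Fin.Properties as Finₚ
open import Data.List using (List; []; _∷_; map; filter; foldr; length; _++_; allFin)
import Data.List.Relation.Unary.All as All
import Data.List.Relation.Unary.All.Properties as Allₚ
open import Data.List.Relation.Unary.Any using (here; there)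
open import Data.List.Membership.Propositional using (_∈_)
open import Data.List.Membership.Propositional.Properties
  using (∈-allFin; ∈-filter⁺; ∈-map⁺; ∈-++⁺ˡ; ∈-++⁺ʳ)
open import Data.Vec using (Vec; []; _∷_; lookup; tabulate)
open import Data.Vec.Properties using (lookup∘tabulate)
open import Data.Sign using (Sign)
import Data.Nat.Combinatorics as Comb
open import Data.Nat.Divisibility using (_∣?_)

import Data.Nat as ℕ
import Data.Nat.Properties as ℕₚ
open ℕ using (ℕ; zero; suc)
import Data.Integer as ℤ
import Data.Integer.Properties as ℤₚ
open ℤ using (ℤ; +_; -[1+_])
import Data.Rational as ℚ
import Data.Rational.Properties as ℚₚ
open ℚ using (ℚ; mkℚ; 0ℚ; 1ℚ; ½)
import Data.Rational.Unnormalised as ℚᵘ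
import Data.Rational.Unnormalised.Properties as ℚᵘₚ

module Rat where
  open import Data.Rational hiding (floor; ceiling; truncate; round)
  open ℚₚ
  open import Data.Rational.Solver using (module +-*-Solver)
  open +-*-Solver

  ∣∣-bound : ∀ {p q} → p ≤ q → - p ≤ q → ∣ p ∣ ≤ q
  ∣∣-bound {p} p≤q -p≤q with ∣p∣≡p∨∣p∣≡-p p
  ... | inj₁ eq = subst (_≤ _) (sym eq) p≤q
  ... | inj₂ eq = subst (_≤ _) (sym eq) -p≤q

  p≤∣p∣ : ∀ p → p ≤ ∣ p ∣
  p≤∣p∣ p with ≤-total 0ℚ p
  ... | inj₁ 0≤p = ≤-reflexive (sym (0≤p⇒∣p∣≡p 0≤p))
  ... | inj₂ p≤0 = ≤-trans p≤0 (0≤∣p∣ p)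

  *-mono : ∀ {p q r s} → 0ℚ ≤ p → 0ℚ ≤ s → p ≤ q → r ≤ s → p * r ≤ q * s
  *-mono {p} {q} {r} {s} 0≤p 0≤s p≤q r≤s =
    ≤-trans (*-monoˡ-≤-nonNeg p {{nonNegative 0≤p}} r≤s)
            (*-monoʳ-≤-nonNeg s {{nonNegative 0≤s}} p≤q)

  *-pos : ∀ {p q} → 0ℚ < p → 0ℚ < q → 0ℚ < p * q
  *-pos {p} {q} 0<p 0<q =
    subst (_< p * q) (*-zeroʳ p) (*-monoʳ-<-pos p {{positive 0<p}} 0<q)

  1/-pos : ∀ {p} (0<p : 0ℚ < p) → 0ℚ < (1/ p) {{>-nonZero 0<p}}
  1/-pos {p} 0<p = positive⁻¹ _ {{1/pos⇒pos p {{positive 0<p}}}}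

  -- total reciprocal, with value 0 at 0
  inv : ℚ → ℚ
  inv p with p ≟ 0ℚ
  ... | yes _   = 0ℚ
  ... | no p≢0 = (1/ p) {{≢-nonZero p≢0}}

  inv-inverse : ∀ {p} → 0ℚ < p → p * inv p ≡ 1ℚ
  inv-inverse {p} 0<p with p ≟ 0ℚ
  ... | yes p≡0 = ⊥-elim (<-irrefl (sym p≡0) 0<p)
  ... | no p≢0 = *-inverseʳ p {{≢-nonZero p≢0}}

  inv-pos : ∀ {p} → 0ℚ < p → 0ℚ < inv p
  inv-pos {p} 0<p with p ≟ 0ℚ
  ... | yes p≡0 = ⊥-elim (<-irrefl (sym p≡0) 0<p)
  ... | no p≢0 = 1/-pos 0<p

  inv-antimono : ∀ {p q} → 0ℚ < p → p ≤ q → inv q ≤ inv p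
  inv-antimono {p} {q} 0<p p≤q = begin
    inv q               ≡⟨ sym (*-identityʳ _) ⟩
    inv q * 1ℚ          ≡⟨ cong (inv q *_) (sym (inv-inverse 0<p)) ⟩
    inv q * (p * inv p) ≤⟨ *-monoˡ-≤-nonNeg (inv q) {{nonNegative 0≤iq}}
                             (*-monoʳ-≤-nonNeg (inv p) {{nonNegative 0≤ip}} p≤q) ⟩
    inv q * (q * inv p) ≡⟨ solve 3 (λ a b c → a :* (b :* c) := (b :* a) :* c) refl
                             (inv q) q (inv p) ⟩
    (q * inv q) * inv p ≡⟨ cong (_* inv p) (inv-inverse 0<q) ⟩
    1ℚ * inv p          ≡⟨ *-identityˡ _ ⟩
    inv p               ∎
    where
    open ≤-Reasoning
    0<q = <-≤-trans 0<p p≤q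
    0≤iq = <⇒≤ (inv-pos 0<q)
    0≤ip = <⇒≤ (inv-pos 0<p)

  inv-diff : ∀ {p q} → 0ℚ < p → 0ℚ < q → inv p - inv q ≡ (inv p * inv q) * (q - p)
  inv-diff {p} {q} 0<p 0<q = begin
    inv p - inv q
      ≡⟨ cong₂ _-_ (sym (*-identityʳ (inv p))) (sym (*-identityʳ (inv q))) ⟩
    inv p * 1ℚ - inv q * 1ℚ
      ≡⟨ cong₂ (λ u v → inv p * u - inv q * v) (sym (inv-inverse 0<q)) (sym (inv-inverse 0<p)) ⟩
    inv p * (q * inv q) - inv q * (p * inv p)
      ≡⟨ solve 4 (λ a b x y → a :* (y :* b) :- b :* (x :* a) := (a :* b) :* (y :- x)) refl
           (inv p) (inv q) p q ⟩
    (inv p * inv q) * (q - p) ∎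
    where open Relation.Binary.PropositionalEquality.≡-Reasoning

  mul-close : ∀ a b c d {B C e f} → ∣ a ∣ ≤ B → ∣ d ∣ ≤ C → ∣ b - d ∣ ≤ e → ∣ a - c ∣ ≤ f →
              ∣ a * b - c * d ∣ ≤ B * e + C * f
  mul-close a b c d {B} {C} {e} {f} ha hd hbd hac = begin
    ∣ a * b - c * d ∣
      ≡⟨ cong ∣_∣ (solve 4 (λ a b c d → a :* b :- c :* d := a :* (b :- d) :+ d :* (a :- c)) refl a b c d) ⟩
    ∣ a * (b - d) + d * (a - c) ∣
      ≤⟨ ∣p+q∣≤∣p∣+∣q∣ (a * (b - d)) (d * (a - c)) ⟩
    ∣ a * (b - d) ∣ + ∣ d * (a - c) ∣
      ≡⟨ cong₂ _+_ (∣p*q∣≡∣p∣*∣q∣ a (b - d)) (∣p*q∣≡∣p∣*∣q∣ d (a - c)) ⟩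
    ∣ a ∣ * ∣ b - d ∣ + ∣ d ∣ * ∣ a - c ∣
      ≤⟨ +-mono-≤
           (*-mono {∣ a ∣} {B} {∣ b - d ∣} {e} (0≤∣p∣ a) (≤-trans (0≤∣p∣ (b - d)) hbd) ha hbd)
           (*-mono {∣ d ∣} {C} {∣ a - c ∣} {f} (0≤∣p∣ d) (≤-trans (0≤∣p∣ (a - c)) hac) hd hac) ⟩
    B * e + C * f ∎
    where open ≤-Reasoning

  quotient : ∀ D e → 0ℚ < D → 0ℚ < e → ∃[ f ] (0ℚ < f × D * f ≡ e)
  quotient D e 0<D 0<e = e * inv D , *-pos 0<e (inv-pos 0<D) , trans
    (solve 3 (λ D e i → D :* (e :* i) := (D :* i) :* e) refl D e (inv D))
    (trans (cong (_* e) (inv-inverse 0<D)) (*-identityˡ e))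

  inv-close : ∀ a b c e → 0ℚ < c → c ≤ a → c ≤ b → ∣ b - a ∣ ≤ c * c * e → ∣ inv a - inv b ∣ ≤ e
  inv-close a b c e 0<c ca cb h = begin
    ∣ inv a - inv b ∣
      ≡⟨ cong ∣_∣ (inv-diff 0<a 0<b) ⟩
    ∣ (inv a * inv b) * (b - a) ∣
      ≡⟨ ∣p*q∣≡∣p∣*∣q∣ (inv a * inv b) (b - a) ⟩
    ∣ inv a * inv b ∣ * ∣ b - a ∣
      ≡⟨ cong (_* ∣ b - a ∣) (0≤p⇒∣p∣≡p 0≤iaib) ⟩
    (inv a * inv b) * ∣ b - a ∣
      ≤⟨ *-mono {inv a * inv b} {i * i} {∣ b - a ∣} {c * c * e} 0≤iaib
           (≤-trans (0≤∣p∣ (b - a)) h)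
           (*-mono {inv a} {i} {inv b} {i} (<⇒≤ (inv-pos 0<a)) (<⇒≤ (inv-pos 0<c))
             (inv-antimono 0<c ca) (inv-antimono 0<c cb)) h ⟩
    (i * i) * (c * c * e)
      ≡⟨ solve 3 (λ i c e → (i :* i) :* (c :* c :* e) := (c :* i) :* ((c :* i) :* e)) refl i c e ⟩
    (c * i) * ((c * i) * e)
      ≡⟨ cong₂ (λ u v → u * (v * e)) (inv-inverse 0<c) (inv-inverse 0<c) ⟩
    1ℚ * (1ℚ * e)
      ≡⟨ trans (*-identityˡ (1ℚ * e)) (*-identityˡ e) ⟩
    e ∎
    where
    open ≤-Reasoning
    i = inv c
    0<a = <-≤-trans 0<c ca
    0<b = <-≤-trans 0<c cb
    0≤iaib = <⇒≤ (*-pos (inv-pos 0<a) (inv-pos 0<b))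

  /-≤ : ∀ m n i j → m ℕ.* suc j ℕ.≤ n ℕ.* suc i → (+ m) / suc i ≤ (+ n) / suc j
  /-≤ m n i j h = toℚᵘ-cancel-≤ (begin
    toℚᵘ ((+ m) / suc i) ≃⟨ toℚᵘ-fromℚᵘ (ℚᵘ.mkℚᵘ (+ m) i) ⟩
    ℚᵘ.mkℚᵘ (+ m) i      ≤⟨ ℚᵘ.*≤* (subst (ℤ._≤ _) (ℤₚ.pos-* m (suc j))
                              (subst (_ ℤ.≤_) (ℤₚ.pos-* n (suc i)) (ℤ.+≤+ h))) ⟩
    ℚᵘ.mkℚᵘ (+ n) j      ≃⟨ ℚᵘₚ.≃-sym (toℚᵘ-fromℚᵘ (ℚᵘ.mkℚᵘ (+ n) j)) ⟩
    toℚᵘ ((+ n) / suc j) ∎)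
    where open ℚᵘₚ.≤-Reasoning

  /-suc : ∀ n j → (+ suc n) / suc j ≡ (+ 1) / suc j + (+ n) / suc j
  /-suc n j = toℚᵘ-injective (begin
    toℚᵘ ((+ suc n) / suc j)
      ≈⟨ toℚᵘ-fromℚᵘ (ℚᵘ.mkℚᵘ (+ suc n) j) ⟩
    ℚᵘ.mkℚᵘ (+ suc n) j
      ≈⟨ ℚᵘ.*≡* (trans (cong (+ suc n ℤ.*_) (ℤₚ.pos-* (suc j) (suc j)))
           (trans (sym (ℤₚ.*-assoc (+ suc n) (+ suc j) (+ suc j)))
                  (cong (ℤ._* + suc j) (ℤₚ.*-distribʳ-+ (+ suc j) (+ 1) (+ n))))) ⟩
    ℚᵘ.mkℚᵘ (+ 1) j ℚᵘ.+ ℚᵘ.mkℚᵘ (+ n) j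
      ≈⟨ ℚᵘₚ.≃-sym (ℚᵘₚ.+-cong (toℚᵘ-fromℚᵘ (ℚᵘ.mkℚᵘ (+ 1) j)) (toℚᵘ-fromℚᵘ (ℚᵘ.mkℚᵘ (+ n) j))) ⟩
    toℚᵘ ((+ 1) / suc j) ℚᵘ.+ toℚᵘ ((+ n) / suc j)
      ≈⟨ ℚᵘₚ.≃-sym (toℚᵘ-homo-+ ((+ 1) / suc j) ((+ n) / suc j)) ⟩
    toℚᵘ ((+ 1) / suc j + (+ n) / suc j) ∎)
    where open import Relation.Binary.Reasoning.Setoid ℚᵘₚ.≃-setoid

  archimedean : ∀ {ε} → 0ℚ < ε → ∃[ N ] ((+ 1) / suc N ≤ ε)
  archimedean {mkℚ (+ zero) d c} (ℚ.*<* (ℤ.+<+ ()))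
  archimedean {mkℚ -[1+ n ] d c} (ℚ.*<* ())
  archimedean {mkℚ (+ suc n) d c} _ = d , toℚᵘ-cancel-≤ (begin
    toℚᵘ ((+ 1) / suc d) ≃⟨ toℚᵘ-fromℚᵘ (ℚᵘ.mkℚᵘ (+ 1) d) ⟩
    ℚᵘ.mkℚᵘ (+ 1) d      ≤⟨ ℚᵘ.*≤* (ℤₚ.*-monoʳ-≤-nonNeg (+ suc d) {+ 1} {+ suc n} (ℤ.+≤+ (ℕ.s≤s ℕ.z≤n))) ⟩
    ℚᵘ.mkℚᵘ (+ suc n) d  ∎)
    where open ℚᵘₚ.≤-Reasoning

  sub-≤ : ∀ {p q r} → p ≤ r + q → p - q ≤ r
  sub-≤ {p} {q} {r} h = begin
    p - q     ≤⟨ +-monoˡ-≤ (- q) h ⟩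
    r + q - q ≡⟨ solve 2 (λ r q → r :+ q :- q := r) refl r q ⟩
    r         ∎
    where open ≤-Reasoning

  half : ∀ ε → 0ℚ < ε → ∃[ e ] (0ℚ < e × e + e ≡ ε)
  half ε 0<ε = ½ * ε , *-pos (positive⁻¹ ½) 0<ε ,
    trans (sym (*-distribʳ-+ ε ½ ½)) (*-identityˡ ε)

-- ⌊ a^(1/q) ⌋

iroot : ℕ → ℕ → ℕ
iroot q zero    = 0
iroot q (suc a) with suc (iroot q a) ℕ.^ q ℕ.≤? suc a
... | yes _ = suc (iroot q a)
... | no _  = iroot q a

iroot-lower : ∀ q .{{_ : ℕ.NonZero q}} a → iroot q a ℕ.^ q ℕ.≤ a
iroot-lower (suc q) zero = ℕ.z≤n
iroot-lower q (suc a) with suc (iroot q a) ℕ.^ q ℕ.≤? suc a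
... | yes h = h
... | no _  = ℕₚ.m≤n⇒m≤1+n (iroot-lower q a)

iroot-upper : ∀ q .{{_ : ℕ.NonZero q}} a → a ℕ.< suc (iroot q a) ℕ.^ q
iroot-upper q zero = ℕₚ.m^n>0 1 q
iroot-upper q (suc a) with suc (iroot q a) ℕ.^ q ℕ.≤? suc a
... | yes _ = ℕₚ.≤-<-trans (iroot-upper q a) (ℕₚ.^-monoˡ-< q (ℕₚ.n<1+n _))
... | no h  = ℕₚ.≰⇒> h

-- Real numbers as Cauchy sequences of rationals.  Two sequences denote the
-- same real when each is _≤ʳ_ the other; _≡_ on ℝ is not the intended equality.

record ℝ : Set where
  constructor mkℝ
  field
    seq    : ℕ → ℚ
    cauchy : ∀ ε → 0ℚ ℚ.< ε →
             ∃[ N ] (∀ m n → N ℕ.≤ m → N ℕ.≤ n → ℚ.∣ seq m ℚ.- seq n ∣ ℚ.≤ ε)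
open ℝ public

infix 4 _≤ʳ_

_≤ʳ_ : ℝ → ℝ → Set
x ≤ʳ y = ∀ ε → 0ℚ ℚ.< ε → ∃[ N ] (∀ m → N ℕ.≤ m → seq x m ℚ.≤ seq y m ℚ.+ ε)

bounded : ∀ x → ∃[ B ] ∃[ N ] (0ℚ ℚ.< B × (∀ m → N ℕ.≤ m → ℚ.∣ seq x m ∣ ℚ.≤ B))
bounded x with cauchy x 1ℚ (ℚₚ.positive⁻¹ 1ℚ)
... | N , close = ∣ c ∣ + 1ℚ , N , +-mono-≤-< (0≤∣p∣ c) (positive⁻¹ 1ℚ) , bound
  where
  open import Data.Rational hiding (floor; ceiling; truncate; round)
  open ℚₚ
  open import Data.Rational.Solver using (module +-*-Solver)
  open +-*-Solver
  c = seq x N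
  bound : ∀ m → N ℕ.≤ m → ∣ seq x m ∣ ≤ ∣ c ∣ + 1ℚ
  bound m N≤m = begin
    ∣ seq x m ∣            ≡⟨ cong ∣_∣ (solve 2 (λ a b → a := b :+ (a :- b)) refl (seq x m) c) ⟩
    ∣ c + (seq x m - c) ∣  ≤⟨ ∣p+q∣≤∣p∣+∣q∣ c (seq x m - c) ⟩
    ∣ c ∣ + ∣ seq x m - c ∣ ≤⟨ +-monoʳ-≤ ∣ c ∣ (close m N N≤m ℕₚ.≤-refl) ⟩
    ∣ c ∣ + 1ℚ             ∎
    where open ≤-Reasoning

fromℚ : ℚ → ℝ
fromℚ p = mkℝ (λ _ → p) λ ε 0<ε → 0 , λ _ _ _ _ →
  subst (λ d → ℚ.∣ d ∣ ℚ.≤ ε) (sym (ℚₚ.+-inverseʳ p)) (ℚₚ.<⇒≤ 0<ε)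

fromℤ : ℤ → ℝ
fromℤ z = fromℚ (z ℚ./ 1)

fromℕ : ℕ → ℝ
fromℕ n = fromℤ (+ n)

infixl 6 _+ʳ_ _-ʳ_
infixl 7 _*ʳ_ _*⁺_ _÷ʳ_
infix  8 -ʳ_
infix  9 _⁻¹
infixr 8 _^ʳ_

_+ʳ_ : ℝ → ℝ → ℝ
x +ʳ y = mkℝ (λ n → seq x n ℚ.+ seq y n) proof
  where
  open import Data.Rational hiding (floor; ceiling; truncate; round)
  open ℚₚ
  open import Data.Rational.Solver using (module +-*-Solver)
  open +-*-Solver
  proof : ∀ ε → 0ℚ < ε →
          ∃[ K ] (∀ m n → K ℕ.≤ m → K ℕ.≤ n → ∣ (seq x m + seq y m) - (seq x n + seq y n) ∣ ≤ ε)
  proof ε 0<ε =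
    let e , 0<e , e+e≡ε = Rat.half ε 0<ε
        N , cx = cauchy x e 0<e
        M , cy = cauchy y e 0<e
    in N ℕ.⊔ M , λ m n hm hn → begin
    ∣ (seq x m + seq y m) - (seq x n + seq y n) ∣
      ≡⟨ cong ∣_∣ (solve 4 (λ a b c d → (a :+ b) :- (c :+ d) := (a :- c) :+ (b :- d)) refl
           (seq x m) (seq y m) (seq x n) (seq y n)) ⟩
    ∣ (seq x m - seq x n) + (seq y m - seq y n) ∣
      ≤⟨ ∣p+q∣≤∣p∣+∣q∣ (seq x m - seq x n) (seq y m - seq y n) ⟩
    ∣ seq x m - seq x n ∣ + ∣ seq y m - seq y n ∣
      ≤⟨ +-mono-≤ (cx m n (ℕₚ.m⊔n≤o⇒m≤o N M hm) (ℕₚ.m⊔n≤o⇒m≤o N M hn))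
                  (cy m n (ℕₚ.m⊔n≤o⇒n≤o N M hm) (ℕₚ.m⊔n≤o⇒n≤o N M hn)) ⟩
    e + e ≡⟨ e+e≡ε ⟩
    ε ∎
    where open ≤-Reasoning

-ʳ_ : ℝ → ℝ
-ʳ x = mkℝ (λ n → ℚ.- seq x n) λ ε 0<ε →
  let N , cx = cauchy x ε 0<ε in
  N , λ m n hm hn → subst (ℚ._≤ ε)
    (trans (sym (ℚₚ.∣-p∣≡∣p∣ (seq x m ℚ.- seq x n)))
           (cong ℚ.∣_∣ (ℚₚ.neg-distrib-+ (seq x m) (ℚ.- seq x n))))
    (cx m n hm hn)

_-ʳ_ : ℝ → ℝ → ℝ
x -ʳ y = x +ʳ -ʳ y

_*ʳ_ : ℝ → ℝ → ℝ
x *ʳ y = mkℝ (λ n → seq x n ℚ.* seq y n) proof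
  where
  open import Data.Rational using (_*_; _-_; _+_; _≤_; _<_; ∣_∣)
  proof : ∀ ε → 0ℚ < ε →
          ∃[ N ] (∀ m n → N ℕ.≤ m → N ℕ.≤ n → ∣ seq x m * seq y m - seq x n * seq y n ∣ ≤ ε)
  proof ε 0<ε =
    let B , N₁ , 0<B , bx = bounded x
        C , N₂ , 0<C , by = bounded y
        e , 0<e , e+e≡ε = Rat.half ε 0<ε
        f , 0<f , Cf≡e = Rat.quotient C e 0<C 0<e
        g , 0<g , Bg≡e = Rat.quotient B e 0<B 0<e
        N₃ , cx = cauchy x f 0<f
        N₄ , cy = cauchy y g 0<g
    in (N₁ ℕ.⊔ N₂) ℕ.⊔ (N₃ ℕ.⊔ N₄) , λ m n hm hn →
    let hm′ = ℕₚ.m⊔n≤o⇒n≤o (N₁ ℕ.⊔ N₂) (N₃ ℕ.⊔ N₄) hm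
        hn′ = ℕₚ.m⊔n≤o⇒n≤o (N₁ ℕ.⊔ N₂) (N₃ ℕ.⊔ N₄) hn
    in subst (∣ seq x m * seq y m - seq x n * seq y n ∣ ≤_)
         (trans (cong₂ _+_ Bg≡e Cf≡e) e+e≡ε)
         (Rat.mul-close (seq x m) (seq y m) (seq x n) (seq y n) {B} {C} {g} {f}
           (bx m (ℕₚ.m⊔n≤o⇒m≤o N₁ N₂ (ℕₚ.m⊔n≤o⇒m≤o (N₁ ℕ.⊔ N₂) (N₃ ℕ.⊔ N₄) hm)))
           (by n (ℕₚ.m⊔n≤o⇒n≤o N₁ N₂ (ℕₚ.m⊔n≤o⇒m≤o (N₁ ℕ.⊔ N₂) (N₃ ℕ.⊔ N₄) hn)))
           (cy m n (ℕₚ.m⊔n≤o⇒n≤o N₃ N₄ hm′) (ℕₚ.m⊔n≤o⇒n≤o N₃ N₄ hn′))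
           (cx m n (ℕₚ.m⊔n≤o⇒m≤o N₃ N₄ hm′) (ℕₚ.m⊔n≤o⇒m≤o N₃ N₄ hn′)))

-- Positive reals, bounded away from 0 so that the reciprocal is constructive

record ℝ⁺ : Set where
  constructor mkℝ⁺
  field
    value    : ℝ
    positive : ∃[ c ] ∃[ N ] (0ℚ ℚ.< c × (∀ m → N ℕ.≤ m → c ℚ.≤ seq value m))
open ℝ⁺ public

_*⁺_ : ℝ⁺ → ℝ⁺ → ℝ⁺
mkℝ⁺ x (c , N , 0<c , hx) *⁺ mkℝ⁺ y (d , M , 0<d , hy) =
  mkℝ⁺ (x *ʳ y) (c ℚ.* d , N ℕ.⊔ M , Rat.*-pos 0<c 0<d , λ m hm →
    let hd = hy m (ℕₚ.m⊔n≤o⇒n≤o N M hm) in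
    Rat.*-mono (ℚₚ.<⇒≤ 0<c) (ℚₚ.≤-trans (ℚₚ.<⇒≤ 0<d) hd)
               (hx m (ℕₚ.m⊔n≤o⇒m≤o N M hm)) hd)

_⁻¹ : ℝ⁺ → ℝ⁺
mkℝ⁺ x (c , N , 0<c , hx) ⁻¹ = mkℝ⁺ (mkℝ (λ n → Rat.inv (seq x n)) proof) lower
  where
  open import Data.Rational using (_*_; _-_; _≤_; _<_; ∣_∣)
  open import Data.Rational.Properties
  proof : ∀ ε → 0ℚ < ε →
          ∃[ K ] (∀ m n → K ℕ.≤ m → K ℕ.≤ n → ∣ Rat.inv (seq x m) - Rat.inv (seq x n) ∣ ≤ ε)
  proof ε 0<ε with cauchy x (c * c * ε) (Rat.*-pos (Rat.*-pos 0<c 0<c) 0<ε)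
  ... | M , cx = N ℕ.⊔ M , λ m n hm hn →
    Rat.inv-close (seq x m) (seq x n) c ε 0<c
      (hx m (ℕₚ.m⊔n≤o⇒m≤o N M hm)) (hx n (ℕₚ.m⊔n≤o⇒m≤o N M hn))
      (cx n m (ℕₚ.m⊔n≤o⇒n≤o N M hn) (ℕₚ.m⊔n≤o⇒n≤o N M hm))
  lower : ∃[ d ] ∃[ M ] (0ℚ < d × (∀ m → M ℕ.≤ m → d ≤ Rat.inv (seq x m)))
  lower =
    let B , M , 0<B , bx = bounded x
    in Rat.inv B , N ℕ.⊔ M , Rat.inv-pos {B} 0<B , λ m hm →
      Rat.inv-antimono {seq x m} {B} (<-≤-trans 0<c (hx m (ℕₚ.m⊔n≤o⇒m≤o N M hm)))
        (≤-trans (Rat.p≤∣p∣ (seq x m)) (bx m (ℕₚ.m⊔n≤o⇒n≤o N M hm)))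

_÷ʳ_ : ℝ → ℝ⁺ → ℝ
x ÷ʳ y = x *ʳ value (y ⁻¹)

-- The real a^(1/q), as the limit of ⌊ (m+1) a^(1/q) ⌋ / (m+1)

root : (q : ℕ) .{{_ : ℕ.NonZero q}} (a : ℕ) .{{_ : ℕ.NonZero a}} → ℝ⁺
root q a = mkℝ⁺ (mkℝ (λ m → (+ s m) ℚ./ suc m) proof) (1ℚ , 0 , ℚₚ.positive⁻¹ 1ℚ , λ m _ → ≥1 m)
  where
  s : ℕ → ℕ
  s m = iroot q (a ℕ.* suc m ℕ.^ q)

  ^-cancel-< : ∀ {u v} → u ℕ.^ q ℕ.< v ℕ.^ q → u ℕ.< v
  ^-cancel-< {u} {v} h with u ℕ.<? v
  ... | yes u<v = u<v
  ... | no u≮v = ⊥-elim (ℕₚ.<⇒≱ h (ℕₚ.^-monoˡ-≤ q (ℕₚ.≮⇒≥ u≮v)))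

  cross : ∀ m n → s m ℕ.* suc n ℕ.< suc (s n) ℕ.* suc m
  cross m n = ^-cancel-< (begin-strict
    (s m ℕ.* suc n) ℕ.^ q           ≡⟨ ^-distribʳ-* q (s m) (suc n) ⟩
    s m ℕ.^ q ℕ.* suc n ℕ.^ q       ≤⟨ *-monoˡ-≤ (suc n ℕ.^ q) (iroot-lower q (a ℕ.* suc m ℕ.^ q)) ⟩
    a ℕ.* suc m ℕ.^ q ℕ.* suc n ℕ.^ q ≡⟨ swap a (suc m ℕ.^ q) (suc n ℕ.^ q) ⟩
    a ℕ.* suc n ℕ.^ q ℕ.* suc m ℕ.^ q <⟨ *-monoˡ-< (suc m ℕ.^ q) {{m^n≢0 (suc m) q}} (iroot-upper q (a ℕ.* suc n ℕ.^ q)) ⟩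
    suc (s n) ℕ.^ q ℕ.* suc m ℕ.^ q ≡⟨ sym (^-distribʳ-* q (suc (s n)) (suc m)) ⟩
    (suc (s n) ℕ.* suc m) ℕ.^ q     ∎)
    where
    open ℕₚ
    open ℕₚ.≤-Reasoning
    swap : ∀ x y z → x ℕ.* y ℕ.* z ≡ x ℕ.* z ℕ.* y
    swap x y z = trans (*-assoc x y z) (trans (cong (x ℕ.*_) (*-comm y z)) (sym (*-assoc x z y)))
    ^-distribʳ-* : ∀ k u v → (u ℕ.* v) ℕ.^ k ≡ u ℕ.^ k ℕ.* v ℕ.^ k
    ^-distribʳ-* zero    u v = refl
    ^-distribʳ-* (suc k) u v = trans (cong (u ℕ.* v ℕ.*_) (^-distribʳ-* k u v))
      (solve 4 (λ u v x y → u :* v :* (x :* y) := u :* x :* (v :* y)) refl u v (u ℕ.^ k) (v ℕ.^ k))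
      where
      open import Data.Nat.Solver using (module +-*-Solver)
      open +-*-Solver

  close : ∀ m n → (+ s m) ℚ./ suc m ℚ.- (+ s n) ℚ./ suc n ℚ.≤ (+ 1) ℚ./ suc n
  close m n = Rat.sub-≤ (subst (_ ℚ.≤_) (Rat./-suc (s n) n)
    (Rat./-≤ (s m) (suc (s n)) m n (ℕₚ.<⇒≤ (cross m n))))

  proof : ∀ ε → 0ℚ ℚ.< ε → _
  proof ε 0<ε with Rat.archimedean 0<ε
  ... | N , 1/N≤ε = N , λ m n hm hn →
    Rat.∣∣-bound (ℚₚ.≤-trans (close m n) (small hn))
      (subst (ℚ._≤ ε) (flip ((+ s n) ℚ./ suc n) ((+ s m) ℚ./ suc m)) (ℚₚ.≤-trans (close n m) (small hm)))
    where
    open import Data.Rational.Solver using (module +-*-Solver)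
    open +-*-Solver
    small : ∀ {k} → N ℕ.≤ k → (+ 1) ℚ./ suc k ℚ.≤ ε
    small {k} h = ℚₚ.≤-trans (Rat./-≤ 1 1 k N (ℕₚ.*-monoʳ-≤ 1 (ℕ.s≤s h))) 1/N≤ε
    flip : ∀ u v → u ℚ.- v ≡ ℚ.- (v ℚ.- u)
    flip = solve 2 (λ u v → u :- v := :- (v :- u)) refl

  ≥1 : ∀ m → 1ℚ ℚ.≤ (+ s m) ℚ./ suc m
  ≥1 m = Rat./-≤ 1 (s m) 0 m (subst (ℕ._≤ s m ℕ.* 1) (sym (ℕₚ.*-identityˡ (suc m)))
    (subst (suc m ℕ.≤_) (sym (ℕₚ.*-identityʳ (s m)))
      (ℕ.s≤s⁻¹ (^-cancel-< (ℕₚ.≤-<-trans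
        (ℕₚ.m≤n*m (suc m ℕ.^ q) a)
        (iroot-upper q (a ℕ.* suc m ℕ.^ q)))))))

-- Powers of a positive integer with rational exponent: b^(p/q) = (b^p)^(1/q)

_^ʳ_ : (b : ℕ) .{{_ : ℕ.NonZero b}} → ℚ → ℝ⁺
b ^ʳ mkℚ (+ p)    q-1 _ = root (suc q-1) (b ℕ.^ p) {{ℕₚ.m^n≢0 b p}}
b ^ʳ mkℚ -[1+ p ] q-1 _ = root (suc q-1) (b ℕ.^ suc p) {{ℕₚ.m^n≢0 b (suc p)}} ⁻¹

-- Finite simple graphs on the vertex set Fin n

record Graph (n : ℕ) : Set₁ where
  field
    _~_      : Rel (Fin n) 0ℓ
    _~?_     : Decidable _~_
    ~-sym    : Symmetric _~_
    ~-irrefl : Irreflexive _≡_ _~_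

∑ : ∀ {A : Set} → List A → (A → ℤ) → ℤ
∑ xs f = foldr ℤ._+_ (+ 0) (map f xs)

⟦_⟧ : Sign → ℤ
⟦ s ⟧ = s ℤ.◃ 1

weight : ∀ {n} → (Fin n → Sign) → ℤ
weight {n} f = ∑ (allFin n) λ v → ⟦ f v ⟧

module _ {n : ℕ} (G : Graph n) where
  open Graph G

  degree : Fin n → ℕ
  degree v = length (filter (v ~?_) (allFin n))

  IsMinimumDegree : ℕ → Set
  IsMinimumDegree δ = (∃[ v ] degree v ≡ δ) × (∀ v → δ ℕ.≤ degree v)

  N[_] : Fin n → List (Fin n)
  N[ v ] = filter (λ x → (x Finₚ.≟ v) ⊎-dec (v ~? x)) (allFin n)

  IsSignedDomination : (Fin n → Sign) → Set
  IsSignedDomination f = ∀ v → + 1 ℤ.≤ ∑ N[ v ] λ x → ⟦ f x ⟧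

  IsSignedDominationNumber : ℤ → Set
  IsSignedDominationNumber γ =
      (∃[ f ] (IsSignedDomination f × weight f ≡ γ))
    × (∀ f → IsSignedDomination f → γ ℤ.≤ weight f)

private
  signs : ∀ n → List (Vec Sign n)
  signs zero    = [] ∷ []
  signs (suc n) = map (Sign.+ ∷_) (signs n) ++ map (Sign.- ∷_) (signs n)

  ∈-signs : ∀ {n} (v : Vec Sign n) → v ∈ signs n
  ∈-signs [] = here refl
  ∈-signs (Sign.+ ∷ v) = ∈-++⁺ˡ (∈-map⁺ (Sign.+ ∷_) (∈-signs v))
  ∈-signs {suc n} (Sign.- ∷ v) =
    ∈-++⁺ʳ (map (Sign.+ ∷_) (signs n)) (∈-map⁺ (Sign.- ∷_) (∈-signs v))

  ∑-cong : ∀ {A : Set} (xs : List A) {f g : A → ℤ} → (∀ x → f x ≡ g x) → ∑ xs f ≡ ∑ xs g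
  ∑-cong []       f≗g = refl
  ∑-cong (x ∷ xs) f≗g = cong₂ ℤ._+_ (f≗g x) (∑-cong xs f≗g)

  ∑-+1 : ∀ {A : Set} (xs : List A) → ∑ xs (λ _ → + 1) ≡ + length xs
  ∑-+1 []       = refl
  ∑-+1 (x ∷ xs) = cong (ℤ._+_ (+ 1)) (∑-+1 xs)

signedDominationNumber-exists : ∀ {n} (G : Graph n) → ∃ (IsSignedDominationNumber G)
signedDominationNumber-exists {n} G =
  weight (lookup best) , (lookup best , best-sd , refl) , λ f f-sd →
    ℤₚ.≤-trans
      (All.lookup (f[argmin]≤f[xs] {f = wt} all⁺ candidates)
        (∈-filter⁺ sd? (∈-signs (tabulate f)) (ext (λ v → sym (lookup∘tabulate f v)) f-sd)))
      (ℤₚ.≤-reflexive (∑-cong (allFin n) λ v → cong ⟦_⟧ (lookup∘tabulate f v)))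
  where
  open import Data.List.Extrema ℤₚ.≤-totalOrder using (argmin; argmin-all; f[argmin]≤f[xs])
  open Graph G

  wt : Vec Sign n → ℤ
  wt s = weight (lookup s)

  sd? : ∀ s → Dec (IsSignedDomination G (lookup s))
  sd? s = Finₚ.all? λ v → + 1 ℤ.≤? ∑ (N[_] G v) λ x → ⟦ lookup s x ⟧

  ext : ∀ {f g} → (∀ v → f v ≡ g v) → IsSignedDomination G f → IsSignedDomination G g
  ext f≗g f-sd v =
    subst (+ 1 ℤ.≤_) (∑-cong (N[_] G v) λ x → cong ⟦_⟧ (f≗g x)) (f-sd v)

  candidates : List (Vec Sign n)
  candidates = filter sd? (signs n)

  all⁺ : Vec Sign n
  all⁺ = tabulate λ _ → Sign.+

  nonempty : ∀ {A : Set} {x : A} {xs} → x ∈ xs → + 1 ℤ.≤ + length xs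
  nonempty (here _)  = ℤ.+≤+ (ℕ.s≤s ℕ.z≤n)
  nonempty (there _) = ℤ.+≤+ (ℕ.s≤s ℕ.z≤n)

  all⁺-sd : IsSignedDomination G (lookup all⁺)
  all⁺-sd = ext (λ v → sym (lookup∘tabulate (λ _ → Sign.+) v)) λ v →
    subst (+ 1 ℤ.≤_) (sym (∑-+1 (N[_] G v)))
      (nonempty (∈-filter⁺ (λ x → (x Finₚ.≟ v) ⊎-dec (v ~? x)) (∈-allFin v) (inj₁ refl)))

  best : Vec Sign n
  best = argmin wt all⁺ candidates

  best-sd : IsSignedDomination G (lookup best)
  best-sd = argmin-all wt all⁺-sd (Allₚ.all-filter sd? (signs n))

γₛ : ∀ {n} → Graph n → ℤ
γₛ G = proj₁ (signedDominationNumber-exists G)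

γₛ-isSignedDominationNumber : ∀ {n} (G : Graph n) → IsSignedDominationNumber G (γₛ G)
γₛ-isSignedDominationNumber G = proj₂ (signedDominationNumber-exists G)

δ′ : ℕ → ℕ
δ′ δ = if does (2 ∣? δ) then suc δ else δ

d̃₀·₅ : ℕ → ℕ
d̃₀·₅ δ = suc (δ′ δ) Comb.C ℕ.⌈ δ′ δ /2⌉

nCk≢0 : ∀ {n k} → k ℕ.≤ n → ℕ.NonZero (n Comb.C k)
nCk≢0 {n}     {zero}  _ = _
nCk≢0 {suc n} {suc k} (ℕ.s≤s k≤n) =
  subst ℕ.NonZero (Comb.nCk+nC[k+1]≡[n+1]C[k+1] n k)
    (ℕ.>-nonZero (ℕₚ.<-≤-trans (ℕ.>-nonZero⁻¹ _ {{nCk≢0 k≤n}}) (ℕₚ.m≤m+n (n Comb.C k) _)))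

d̃₀·₅≢0 : ∀ δ → ℕ.NonZero (d̃₀·₅ δ)
d̃₀·₅≢0 δ = nCk≢0 (ℕₚ.m≤n⇒m≤1+n (ℕₚ.⌈n/2⌉≤n (δ′ δ)))

⌊δ/2⌋≢0 : ∀ {δ} → 1 ℕ.< δ → ℕ.NonZero ℕ.⌊ δ /2⌋
⌊δ/2⌋≢0 (ℕ.s≤s (ℕ.s≤s _)) = _

{-# OPTIONS --safe #-}

-- Give the value −1 to a random set M of vertices, each chosen independently with probability q, and
-- let k_v = ⌊deg v / 2⌋.  The condition at v fails only if ∣M ∩ N[v]∣ > k_v, and it is repaired by
-- turning ∣M ∩ N[v]∣ − k_v ≤ C(∣M ∩ N[v]∣, k_v + 1) vertices back to +1.  The expectation of this
-- binomial coefficient is C(deg v + 1, k_v + 1) q^(k_v + 1) ≤ C(2 k_v + 2, k_v + 1) q^(k_v + 1), which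
-- for q ≤ 1/4 is nonincreasing in k_v, hence at most d̃ q^(δ̂ + 1).  Therefore
-- γₛ ≤ n (1 − 2 q + 2 d̃ q^(δ̂ + 1)), with optimum at q = ((1 + δ̂) d̃)^(−1/δ̂), and this q is at most 1/4
-- because 4^δ̂ ≤ (1 + δ̂) d̃.  Since it need not be rational, the argument is run for rational q slightly
-- below it, obtained from the approximations to the two roots in the bound.

module Submission where

open import Defs
open import Algebra.Bundles using (CommutativeRing)
open import Data.Bool using (true; false; if_then_else_)
open import Data.Fin using (Fin; zero; suc)
import Data.Fin.Properties as Finₚ
open import Data.Fin.Subset using (Subset; inside; outside; ∣_∣; _∩_; _⊆_; _∈_; ⊤)
  renaming (_-_ to _∖_)
import Data.Fin.Subset.Properties as Subₚ
import Data.Integer as ℤ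
import Data.Integer.Properties as ℤₚ
open import Data.Integer.Solver renaming (module +-*-Solver to ℤ-Solver)
open import Data.List as List using (List; []; _∷_; length; filter; allFin)
import Data.List.Membership.Propositional.Properties as ∈ₚ
import Data.List.Properties as Listₚ
open import Data.List.Relation.Unary.All as All using (All; []; _∷_)
import Data.List.Relation.Unary.All.Properties as Allₚ
open import Data.Nat as ℕ using (zero; pred; ⌈_/2⌉; z≤n; s≤s)
open import Data.Nat.Combinatorics using (_C_; nCk+nC[k+1]≡[n+1]C[k+1]; nCk≡nC[n∸k]; nC1≡n)
import Data.Nat.Coprimality as Coprime
open import Data.Nat.Divisibility using (_∣_; _∣?_; m∣m*n; ∣m+n∣m⇒∣n; ∣1⇒≡1)
open import Data.Nat.ListAction using (sum)
import Data.Nat.Properties as ℕₚ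
open import Data.Nat.Tactic.RingSolver using (solve-∀)
open import Data.Product using (∃-syntax; _×_; _,_; proj₁; proj₂)
open import Data.Rational using (ℚ; mkℚ; 0ℚ; *≤*; nonNegative; toℚᵘ)
import Data.Rational.Properties as ℚₚ
open import Data.Rational.Solver using (module +-*-Solver)
import Data.Rational.Unnormalised as ℚᵘ
import Data.Rational.Unnormalised.Properties as ℚᵘₚ
open import Data.Sign using (Sign)
open import Data.Sum using (_⊎_; inj₁; inj₂)
open import Data.Unit using (tt)
open import Data.Vec using ([]; _∷_; lookup; tabulate)
import Data.Vec.Properties as Vecₚ
open import Function using (_∘_; id)
open import Relation.Binary.PropositionalEquality
open import Relation.Nullary using (yes; no; does; contradiction)
open import Relation.Nullary.Decidable using (dec-true; dec-false; _⊎-dec_)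
open import Relation.Unary using (Decidable)
open import Relation.Unary.Properties using (U?)
open import Data.Nat using (ℕ; suc; NonZero; ⌊_/2⌋)
open import Data.Integer using (+_)
open import Data.Rational using (1ℚ)

-- Binomial coefficients.

module _ where
  open import Data.Nat using (_+_; _*_; _^_; _∸_; _≤_; _<_; _≤?_; _≤′_; ≤′-refl; ≤′-step)

  pascal : ∀ n k → suc n C suc k ≡ n C k + n C suc k
  pascal n k = sym (nCk+nC[k+1]≡[n+1]C[k+1] n k)

  C-monoˡ-≤ : ∀ k {m n} → m ≤ n → m C k ≤ n C k
  C-monoˡ-≤ k m≤n = go k (ℕₚ.≤⇒≤′ m≤n)
    where
    step : ∀ k n → n C k ≤ suc n C k
    step zero    n = ℕₚ.≤-refl
    step (suc k) n = subst (n C suc k ≤_) (sym (pascal n k)) (ℕₚ.m≤n+m (n C suc k) (n C k))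
    go : ∀ k {m n} → m ≤′ n → m C k ≤ n C k
    go k ≤′-refl           = ℕₚ.≤-refl
    go k (≤′-step {n} m≤n) = ℕₚ.≤-trans (go k m≤n) (step k n)

  -- By Pascal's rule: the excess for `suc m` and `suc k` is the one for `m` and `k`, which bounds
  -- the first summand from below. This trades the number of repairs for a quantity whose
  -- expectation `𝔼-C` computes.
  excess≤C : ∀ m k → m ∸ k ≤ m C suc k
  excess≤C zero    k       = subst (_≤ 0 C suc k) (sym (ℕₚ.0∸n≡0 k)) z≤n
  excess≤C (suc m) zero    = ℕₚ.≤-reflexive (sym (nC1≡n (suc m)))
  excess≤C (suc m) (suc k) = ℕₚ.≤-trans (excess≤C m k)
    (subst (m C suc k ≤_) (sym (pascal m (suc k))) (ℕₚ.m≤m+n (m C suc k) (m C suc (suc k))))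

  C-absorption : ∀ n k → suc k * (suc n C suc k) ≡ suc n * (n C k)
  C-absorption n       zero    = trans (ℕₚ.*-identityˡ (suc n C 1))
    (trans (nC1≡n (suc n)) (sym (ℕₚ.*-identityʳ (suc n))))
  C-absorption zero    (suc k) = trans (cong (suc (suc k) *_) (pascal 0 (suc k))) (ℕₚ.*-zeroʳ (suc (suc k)))
  C-absorption (suc n) (suc k) = begin
    suc (suc k) * (suc (suc n) C suc (suc k))
      ≡⟨ cong (suc (suc k) *_) (pascal (suc n) (suc k)) ⟩
    suc (suc k) * (x + y)
      ≡⟨ expand k x y ⟩
    suc k * x + x + suc (suc k) * y
      ≡⟨ cong₂ (λ u v → u + x + v) (C-absorption n k) (C-absorption n (suc k)) ⟩
    suc n * (n C k) + x + suc n * (n C suc k)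
      ≡⟨ collect n (n C k) (n C suc k) x ⟩
    suc n * (n C k + n C suc k) + x
      ≡⟨ cong (λ u → suc n * u + x) (sym (pascal n k)) ⟩
    suc n * x + x
      ≡⟨ ℕₚ.+-comm (suc n * x) x ⟩
    suc (suc n) * x ∎
    where
    open ≡-Reasoning
    x = suc n C suc k
    y = suc n C suc (suc k)
    expand : ∀ k x y → suc (suc k) * (x + y) ≡ suc k * x + x + suc (suc k) * y
    expand = solve-∀
    collect : ∀ n a b x → suc n * a + x + suc n * b ≡ suc n * (a + b) + x
    collect = solve-∀

  centralBinomial : ℕ → ℕ
  centralBinomial m = (2 * m) C m

  -- Absorption is applied twice; in between, the symmetry C(2m+1, m) = C(2m+1, m+1) brings the
  -- lower index back to `suc m`.
  centralBinomial-suc : ∀ m → suc m * centralBinomial (suc m) ≡ 2 * suc (2 * m) * centralBinomial m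
  centralBinomial-suc m = begin
    suc m * ((2 * suc m) C suc m)       ≡⟨ cong (λ u → suc m * (u C suc m)) 2+2m ⟩
    suc m * (suc (suc (2 * m)) C suc m) ≡⟨ C-absorption (suc (2 * m)) m ⟩
    suc (suc (2 * m)) * (suc (2 * m) C m) ≡⟨ cong (suc (suc (2 * m)) *_) middle ⟩
    suc (suc (2 * m)) * (suc (2 * m) C suc m) ≡⟨ assoc m (suc (2 * m) C suc m) ⟩
    2 * (suc m * (suc (2 * m) C suc m)) ≡⟨ cong (2 *_) (C-absorption (2 * m) m) ⟩
    2 * (suc (2 * m) * centralBinomial m) ≡⟨ sym (ℕₚ.*-assoc 2 (suc (2 * m)) (centralBinomial m)) ⟩
    2 * suc (2 * m) * centralBinomial m ∎
    where
    open ≡-Reasoning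
    2+2m : 2 * suc m ≡ suc (suc (2 * m))
    2+2m = ℕₚ.*-suc 2 m
    m≤ : m ≤ suc (2 * m)
    m≤ = ℕₚ.m≤n⇒m≤1+n (ℕₚ.m≤n*m m 2)
    middle : suc (2 * m) C m ≡ suc (2 * m) C suc m
    middle = trans (nCk≡nC[n∸k] m≤) (cong (suc (2 * m) C_)
      (trans (cong (_∸ m) (split m)) (ℕₚ.m+n∸m≡n m (suc m))))
      where
      split : ∀ m → suc (2 * m) ≡ m + suc m
      split = solve-∀
    assoc : ∀ m x → suc (suc (2 * m)) * x ≡ 2 * (suc m * x)
    assoc = solve-∀

  -- The ratio of consecutive terms is 4 - 2/(m+1). This 4 is the source of the condition 4q ≤ 1.
  centralBinomial-suc≤ : ∀ m → centralBinomial (suc m) ≤ 4 * centralBinomial m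
  centralBinomial-suc≤ m = ℕₚ.*-cancelˡ-≤ (suc m) (begin
    suc m * centralBinomial (suc m)     ≡⟨ centralBinomial-suc m ⟩
    2 * suc (2 * m) * centralBinomial m ≤⟨ ℕₚ.m≤m+n _ (2 * centralBinomial m) ⟩
    2 * suc (2 * m) * centralBinomial m + 2 * centralBinomial m ≡⟨ collect m (centralBinomial m) ⟩
    suc m * (4 * centralBinomial m)     ∎)
    where
    open ℕₚ.≤-Reasoning
    collect : ∀ m x → 2 * suc (2 * m) * x + 2 * x ≡ suc m * (4 * x)
    collect = solve-∀

  -- Passing from `k` to `suc k` multiplies the right side by 4 + 2/(k+1). The bound is what keeps
  -- the optimal probability at most 1/4.
  4^k≤[1+k]*centralBinomial : ∀ k → 4 ^ k ≤ suc k * centralBinomial (suc k)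
  4^k≤[1+k]*centralBinomial zero    = s≤s z≤n
  4^k≤[1+k]*centralBinomial (suc k) = begin
    4 * 4 ^ k                            ≤⟨ ℕₚ.*-monoʳ-≤ 4 (4^k≤[1+k]*centralBinomial k) ⟩
    4 * (suc k * x)                      ≤⟨ ℕₚ.m≤m+n _ (2 * x) ⟩
    4 * (suc k * x) + 2 * x              ≡⟨ collect k x ⟩
    2 * suc (2 * suc k) * x              ≡⟨ sym (centralBinomial-suc (suc k)) ⟩
    suc (suc k) * centralBinomial (suc (suc k)) ∎
    where
    open ℕₚ.≤-Reasoning
    x = centralBinomial (suc k)
    collect : ∀ k x → 4 * (suc k * x) + 2 * x ≡ 2 * suc (2 * suc k) * x
    collect = solve-∀

  -- Thinning a set to meet quotas.

  ∩-monoˡ-∣∣ : ∀ {n} {p q : Subset n} (s : Subset n) → p ⊆ q → ∣ p ∩ s ∣ ≤ ∣ q ∩ s ∣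
  ∩-monoˡ-∣∣ {_} {p} {q} s p⊆q = Subₚ.p⊆q⇒∣p∣≤∣q∣ λ x∈ →
    let x∈p , x∈s = Subₚ.x∈p∩q⁻ p s x∈ in Subₚ.x∈p∩q⁺ (p⊆q x∈p , x∈s)

  -- The first `k` elements of `M ∩ S` are kept and the later ones deleted, so the number of
  -- deletions is exactly the excess.
  thin : ∀ {n} (M S : Subset n) k →
         ∃[ M′ ] (M′ ⊆ M × ∣ M′ ∩ S ∣ ≤ k × ∣ M ∣ ≤ ∣ M′ ∣ + (∣ M ∩ S ∣ ∸ k))
  thin [] [] k = [] , (λ ()) , z≤n , z≤n
  thin (inside ∷ M) (inside ∷ S) zero =
    let M′ , sub , few , big = thin M S zero in
    outside ∷ M′ , Subₚ.out⊆ sub , few ,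
    subst (suc ∣ M ∣ ≤_) (sym (ℕₚ.+-suc ∣ M′ ∣ ∣ M ∩ S ∣)) (s≤s big)
  thin (inside ∷ M) (inside ∷ S) (suc k) =
    let M′ , sub , few , big = thin M S k in
    inside ∷ M′ , Subₚ.s⊆s sub , s≤s few , s≤s big
  thin (inside ∷ M) (outside ∷ S) k =
    let M′ , sub , few , big = thin M S k in
    inside ∷ M′ , Subₚ.s⊆s sub , few , s≤s big
  thin (outside ∷ M) (_ ∷ S) k =
    let M′ , sub , few , big = thin M S k in
    outside ∷ M′ , Subₚ.s⊆s sub , few , big

  -- The constraints are treated one after another. Later deletions preserve quotas already met, and
  -- an excess never grows as the set shrinks, so each excess may be measured in the original `M`.
  thinAll : ∀ {n} (cs : List (Subset n × ℕ)) (M : Subset n) →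
            ∃[ M′ ] (M′ ⊆ M × All (λ (S , k) → ∣ M′ ∩ S ∣ ≤ k) cs ×
                     ∣ M ∣ ≤ ∣ M′ ∣ + sum (List.map (λ (S , k) → ∣ M ∩ S ∣ ∸ k) cs))
  thinAll []             M = M , (λ x∈ → x∈) , [] , ℕₚ.≤-reflexive (sym (ℕₚ.+-identityʳ ∣ M ∣))
  thinAll ((S , k) ∷ cs) M =
    let M₁ , sub₁ , few₁ , big₁ = thinAll cs M
        M₂ , sub₂ , few₂ , big₂ = thin M₁ S k
        rest = sum (List.map (λ (S , k) → ∣ M ∩ S ∣ ∸ k) cs)
    in M₂ , (λ x∈ → sub₁ (sub₂ x∈)) ,
       few₂ ∷ All.map (λ {(S′ , _)} → ℕₚ.≤-trans (∩-monoˡ-∣∣ S′ sub₂)) few₁ , (begin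
         ∣ M ∣                                  ≤⟨ big₁ ⟩
         ∣ M₁ ∣ + rest                          ≤⟨ ℕₚ.+-monoˡ-≤ rest big₂ ⟩
         ∣ M₂ ∣ + (∣ M₁ ∩ S ∣ ∸ k) + rest       ≤⟨ ℕₚ.+-monoˡ-≤ rest (ℕₚ.+-monoʳ-≤ ∣ M₂ ∣
                                                     (ℕₚ.∸-monoˡ-≤ k (∩-monoˡ-∣∣ S sub₁))) ⟩
         ∣ M₂ ∣ + (∣ M ∩ S ∣ ∸ k) + rest        ≡⟨ ℕₚ.+-assoc ∣ M₂ ∣ (∣ M ∩ S ∣ ∸ k) rest ⟩
         ∣ M₂ ∣ + ((∣ M ∩ S ∣ ∸ k) + rest)      ∎)
    where open ℕₚ.≤-Reasoning

  -- Powers of natural numbers.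

  ^-ℕ-distribʳ-* : ∀ k u v → (u * v) ^ k ≡ u ^ k * v ^ k
  ^-ℕ-distribʳ-* zero    u v = refl
  ^-ℕ-distribʳ-* (suc k) u v = trans (cong (u * v *_) (^-ℕ-distribʳ-* k u v)) (swap u v (u ^ k) (v ^ k))
    where
    swap : ∀ u v x y → u * v * (x * y) ≡ u * x * (v * y)
    swap = solve-∀

  ^-ℕ-cancelʳ-≤ : ∀ k .{{_ : NonZero k}} {m n} → m ^ k ≤ n ^ k → m ≤ n
  ^-ℕ-cancelʳ-≤ k {m} {n} le with m ≤? n
  ... | yes m≤n = m≤n
  ... | no m≰n = contradiction le (ℕₚ.<⇒≱ (ℕₚ.^-monoˡ-< k (ℕₚ.≰⇒> m≰n)))

  -- Subsets cut out by predicates, and signed sums.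

  module _ {m} {P : Fin m → Set} (P? : Decidable P) where

    -- Carrying `h` lets inductions on `n` pass to `h ∘ suc` while `P?` stays fixed; the case
    -- applied to graphs is `h = id`.
    subset : ∀ {n} → (Fin n → Fin m) → Subset n
    subset h = tabulate (does ∘ P? ∘ h)

    ∈-subset⁺ : ∀ {x} → P x → x ∈ subset id
    ∈-subset⁺ {x} px = Vecₚ.lookup⇒[]= x _ (trans (Vecₚ.lookup∘tabulate _ x) (dec-true (P? x) px))

    ∈-subset⁻ : ∀ {x} → x ∈ subset id → P x
    ∈-subset⁻ {x} x∈ with P? x | trans (sym (Vecₚ.lookup∘tabulate (does ∘ P?) x)) (Vecₚ.[]=⇒lookup x∈)
    ... | yes px | _ = px
    ... | no _   | ()

    length-filter : ∀ {n} (h : Fin n → Fin m) → length (filter P? (List.tabulate h)) ≡ ∣ subset h ∣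
    length-filter {zero}  h = refl
    length-filter {suc n} h with P? (h zero)
    ... | yes _ = cong suc (length-filter (h ∘ suc))
    ... | no _  = length-filter (h ∘ suc)

  ℤ-+-cancelʳ-≤ : ∀ k {i j} → i ℤ.+ k ℤ.≤ j ℤ.+ k → i ℤ.≤ j
  ℤ-+-cancelʳ-≤ k {i} {j} le = subst₂ ℤ._≤_ (cancel i k) (cancel j k) (ℤₚ.+-monoˡ-≤ (ℤ.- k) le)
    where
    cancel : ∀ i k → i ℤ.+ k ℤ.- k ≡ i
    cancel = ℤ-Solver.solve 2 (λ i k → i ℤ-Solver.:+ k ℤ-Solver.:- k ℤ-Solver.:= i) refl

  minusOn : ∀ {n} → Subset n → Fin n → Sign
  minusOn M x = if lookup M x then Sign.- else Sign.+

  module _ {m} {P : Fin m → Set} (P? : Decidable P) (M : Subset m) where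

    -- A value -1 falls short of 1 by 2, so adding 2 for each selected element of `M` restores a
    -- plain count.
    ∑-minusOn : ∀ {n} (h : Fin n → Fin m) →
      ∑ (filter P? (List.tabulate h)) (λ x → ⟦ minusOn M x ⟧)
        ℤ.+ + (2 * ∣ tabulate (lookup M ∘ h) ∩ subset P? h ∣)
      ≡ + ∣ subset P? h ∣
    ∑-minusOn {zero}  h = refl
    ∑-minusOn {suc n} h with P? (h zero) | lookup M (h zero) in M-h0
    ... | no _  | true  = ∑-minusOn (h ∘ suc)
    ... | no _  | false = ∑-minusOn (h ∘ suc)
    ... | yes _ | true  rewrite M-h0 = begin
      (ℤ.- + 1 ℤ.+ s) ℤ.+ + (2 * suc c)
        ≡⟨ cong (λ z → (ℤ.- + 1 ℤ.+ s) ℤ.+ + z) (ℕₚ.*-suc 2 c) ⟩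
      (ℤ.- + 1 ℤ.+ s) ℤ.+ (+ 2 ℤ.+ + (2 * c))
        ≡⟨ ℤ-Solver.solve 2 (λ s c → (ℤ-Solver.con (ℤ.- + 1) ℤ-Solver.:+ s) ℤ-Solver.:+ (ℤ-Solver.con (+ 2) ℤ-Solver.:+ c)
             ℤ-Solver.:= ℤ-Solver.con (+ 1) ℤ-Solver.:+ (s ℤ-Solver.:+ c)) refl s (+ (2 * c)) ⟩
      + 1 ℤ.+ (s ℤ.+ + (2 * c))
        ≡⟨ cong ℤ.suc (∑-minusOn (h ∘ suc)) ⟩
      + suc ∣ subset P? (h ∘ suc) ∣ ∎
      where
      open ≡-Reasoning
      s = ∑ (filter P? (List.tabulate (h ∘ suc))) (λ x → ⟦ minusOn M x ⟧)
      c = ∣ tabulate (lookup M ∘ h ∘ suc) ∩ subset P? (h ∘ suc) ∣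
    ... | yes _ | false rewrite M-h0 =
      trans (ℤₚ.+-assoc (+ 1) (∑ (filter P? (List.tabulate (h ∘ suc))) (λ x → ⟦ minusOn M x ⟧)) _)
            (cong ℤ.suc (∑-minusOn (h ∘ suc)))

    ∑-minusOn-id :
      ∑ (filter P? (allFin m)) (λ x → ⟦ minusOn M x ⟧) ℤ.+ + (2 * ∣ M ∩ subset P? id ∣)
      ≡ + ∣ subset P? id ∣
    ∑-minusOn-id = subst
      (λ M′ → ∑ (filter P? (allFin m)) (λ x → ⟦ minusOn M x ⟧) ℤ.+ + (2 * ∣ M′ ∩ subset P? id ∣)
            ≡ + ∣ subset P? id ∣)
      (Vecₚ.tabulate∘lookup M) (∑-minusOn id)

  -- The weight is the sum filtered by the always true predicate `U?`, so `∑-minusOn-id` applies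
  -- with `⊤` as the selected set.
  weight-minusOn : ∀ {n} (M : Subset n) → weight (minusOn M) ℤ.+ + (2 * ∣ M ∣) ≡ + n
  weight-minusOn {n} M = trans
    (cong₂ (λ xs k → ∑ xs (λ x → ⟦ minusOn M x ⟧) ℤ.+ + (2 * k))
      (sym (Listₚ.filter-all U? (All.universal (λ _ → tt) (allFin n))))
      (cong ∣_∣ (trans (sym (Subₚ.∩-identityʳ M)) (cong (M ∩_) (sym all≡⊤)))))
    (trans (∑-minusOn-id U? M) (cong +_ (trans (cong ∣_∣ all≡⊤) (Subₚ.∣⊤∣≡n n))))
    where
    all≡⊤ : subset {n} U? id ≡ ⊤
    all≡⊤ = Subₚ.⊆-antisym Subₚ.⊆⊤ (λ _ → ∈-subset⁺ U? tt)

  -- Halving, and `d̃₀·₅` as a central binomial coefficient.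

  2*⌊n/2⌋≤n : ∀ n → 2 * ⌊ n /2⌋ ≤ n
  2*⌊n/2⌋≤n n = subst₂ _≤_ (cong (λ z → ⌊ n /2⌋ + z) (sym (ℕₚ.+-identityʳ ⌊ n /2⌋))) (ℕₚ.⌊n/2⌋+⌈n/2⌉≡n n)
    (ℕₚ.+-monoʳ-≤ ⌊ n /2⌋ (ℕₚ.⌊n/2⌋≤⌈n/2⌉ n))

  parity : ∀ n → n ≡ 2 * ⌊ n /2⌋ ⊎ n ≡ suc (2 * ⌊ n /2⌋)
  parity zero          = inj₁ refl
  parity (suc zero)    = inj₂ refl
  parity (suc (suc n)) with parity n
  ... | inj₁ eq = inj₁ (trans (cong (2 ℕ.+_) eq) (sym (ℕₚ.*-suc 2 ⌊ n /2⌋)))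
  ... | inj₂ eq = inj₂ (trans (cong (2 ℕ.+_) eq) (cong suc (sym (ℕₚ.*-suc 2 ⌊ n /2⌋))))

  n<2*suc⌊n/2⌋ : ∀ n → n < 2 * suc ⌊ n /2⌋
  n<2*suc⌊n/2⌋ n = subst (n <_) (sym (ℕₚ.*-suc 2 ⌊ n /2⌋)) (ℕ.s≤s (bound (parity n)))
    where
    bound : n ≡ 2 * ⌊ n /2⌋ ⊎ n ≡ suc (2 * ⌊ n /2⌋) → n ≤ suc (2 * ⌊ n /2⌋)
    bound (inj₁ eq) = ℕₚ.m≤n⇒m≤1+n (ℕₚ.≤-reflexive eq)
    bound (inj₂ eq) = ℕₚ.≤-reflexive eq

  -- An even `δ` is raised by one and an odd one is kept, so both parities lead to the same odd
  -- number; were the odd `δ` divisible by 2, so would be 1.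
  δ′≡ : ∀ δ → δ′ δ ≡ suc (2 * ⌊ δ /2⌋)
  δ′≡ δ with parity δ
  ... | inj₁ even = trans (cong (if_then suc δ else δ) (dec-true (2 ∣? δ) (subst (2 ∣_) (sym even) (m∣m*n ⌊ δ /2⌋)))) (cong suc even)
  ... | inj₂ odd = trans (cong (if_then suc δ else δ) (dec-false (2 ∣? δ) λ 2∣δ → contradiction
      (∣1⇒≡1 (∣m+n∣m⇒∣n (subst (2 ∣_) (trans odd (ℕₚ.+-comm 1 (2 * ⌊ δ /2⌋))) 2∣δ) (m∣m*n ⌊ δ /2⌋))) λ ())) odd

  d̃≡centralBinomial : ∀ δ → d̃₀·₅ δ ≡ centralBinomial (suc ⌊ δ /2⌋)
  d̃≡centralBinomial δ = trans (cong (λ d → suc d C ⌈ d /2⌉) (δ′≡ δ))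
    (cong₂ _C_ (sym (ℕₚ.*-suc 2 ⌊ δ /2⌋)) (cong suc half))
    where
    half : ⌊ 2 * ⌊ δ /2⌋ /2⌋ ≡ ⌊ δ /2⌋
    half = trans (cong (λ z → ⌊ ⌊ δ /2⌋ + z /2⌋) (ℕₚ.+-identityʳ ⌊ δ /2⌋)) (sym (ℕₚ.n≡⌊n+n/2⌋ ⌊ δ /2⌋))

-- Integers and natural numbers inside the rationals.

module _ where
  open import Data.Rational using (_+_; _*_; _-_; -_; _/_; _≤_; _<_)
  open import Algebra.Properties.CommutativeSemiring.Exp
    (CommutativeRing.commutativeSemiring ℚₚ.+-*-commutativeRing)
    using (_^_; ^-distrib-*)
  open +-*-Solver using (solve; _:+_; _:*_; _:-_; _:=_; con)

  -- The gcd normalisation in `_/_` is stuck on a variable `z`; once it is replaced by an explicit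
  -- `mkℚ`, sums, products and comparisons unfold.
  /1-normal : ∀ z → z / 1 ≡ mkℚ z 0 (Coprime.sym (Coprime.1-coprimeTo ℤ.∣ z ∣))
  /1-normal z = ℚₚ.↥p/↧p≡p (mkℚ z 0 (Coprime.sym (Coprime.1-coprimeTo ℤ.∣ z ∣)))

  /1-homo-+ : ∀ x y → (x ℤ.+ y) / 1 ≡ x / 1 + y / 1
  /1-homo-+ x y = trans (ℚₚ./-cong (cong₂ ℤ._+_ (sym (ℤₚ.*-identityʳ x)) (sym (ℤₚ.*-identityʳ y))) refl)
                        (sym (cong₂ _+_ (/1-normal x) (/1-normal y)))

  /1-homo-* : ∀ x y → (x ℤ.* y) / 1 ≡ x / 1 * (y / 1)
  /1-homo-* x y = sym (cong₂ _*_ (/1-normal x) (/1-normal y))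

  /1-mono-≤ : ∀ {x y} → x ℤ.≤ y → x / 1 ≤ y / 1
  /1-mono-≤ {x} {y} x≤y = subst₂ _≤_ (sym (/1-normal x)) (sym (/1-normal y))
    (*≤* (ℤₚ.*-monoʳ-≤-nonNeg (+ 1) x≤y))

  -- By definition the constant term of `fromℕ n`, so estimates in terms of `ι` carry over to the
  -- real inequality directly.
  ι : ℕ → ℚ
  ι n = + n / 1

  ι-homo-+ : ∀ m n → ι (m ℕ.+ n) ≡ ι m + ι n
  ι-homo-+ m n = /1-homo-+ (+ m) (+ n)

  ι-homo-* : ∀ m n → ι (m ℕ.* n) ≡ ι m * ι n
  ι-homo-* m n = trans (cong (_/ 1) (ℤₚ.pos-* m n)) (/1-homo-* (+ m) (+ n))

  ι-homo-^ : ∀ m k → ι (m ℕ.^ k) ≡ ι m ^ k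
  ι-homo-^ m zero    = refl
  ι-homo-^ m (suc k) = trans (ι-homo-* m (m ℕ.^ k)) (cong (ι m *_) (ι-homo-^ m k))

  ι-mono-≤ : ∀ {m n} → m ℕ.≤ n → ι m ≤ ι n
  ι-mono-≤ m≤n = /1-mono-≤ (ℤ.+≤+ m≤n)

  0≤ι : ∀ n → 0ℚ ≤ ι n
  0≤ι n = ι-mono-≤ {0} {n} ℕ.z≤n

  1≤ι-suc : ∀ n → 1ℚ ≤ ι (suc n)
  1≤ι-suc n = ι-mono-≤ {1} {suc n} (ℕ.s≤s ℕ.z≤n)

  0<1 : 0ℚ < 1ℚ
  0<1 = ℚₚ.positive⁻¹ 1ℚ

  0<ι-suc : ∀ n → 0ℚ < ι (suc n)
  0<ι-suc n = ℚₚ.<-≤-trans 0<1 (1≤ι-suc n)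

  *-monoʳ : ∀ {p q r} → 0ℚ ≤ r → p ≤ q → r * p ≤ r * q
  *-monoʳ {r = r} 0≤r = ℚₚ.*-monoˡ-≤-nonNeg r {{nonNegative 0≤r}}

  *-monoˡ : ∀ {p q r} → 0ℚ ≤ r → p ≤ q → p * r ≤ q * r
  *-monoˡ {r = r} 0≤r = ℚₚ.*-monoʳ-≤-nonNeg r {{nonNegative 0≤r}}

  p≤q⇒0≤q-p : ∀ {p q} → p ≤ q → 0ℚ ≤ q - p
  p≤q⇒0≤q-p {p} {q} p≤q = subst (_≤ q - p) (ℚₚ.+-inverseʳ p) (ℚₚ.+-monoˡ-≤ (- p) p≤q)

  0≤p*q : ∀ {p q} → 0ℚ ≤ p → 0ℚ ≤ q → 0ℚ ≤ p * q
  0≤p*q {p} 0≤p 0≤q = subst (_≤ p * _) (ℚₚ.*-zeroʳ p) (*-monoʳ 0≤p 0≤q)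

  0≤p^k : ∀ {p} k → 0ℚ ≤ p → 0ℚ ≤ p ^ k
  0≤p^k zero    0≤p = ℚₚ.<⇒≤ 0<1
  0≤p^k (suc k) 0≤p = 0≤p*q 0≤p (0≤p^k k 0≤p)

  -- Expectation over random subsets, and the deletion method.

  module Random (q : ℚ) (0≤q : 0ℚ ≤ q) (q≤1 : q ≤ 1ℚ) where

    -- Expectation over a random subset that contains each element independently with probability q.
    𝔼 : ∀ {n} → (Subset n → ℚ) → ℚ
    𝔼 {zero}  F = F []
    𝔼 {suc n} F = q * 𝔼 (F ∘ (inside ∷_)) + (1ℚ - q) * 𝔼 (F ∘ (outside ∷_))

    𝔼-cong : ∀ {n} {F G : Subset n → ℚ} → (∀ M → F M ≡ G M) → 𝔼 F ≡ 𝔼 G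
    𝔼-cong {zero}  F≗G = F≗G []
    𝔼-cong {suc n} F≗G = cong₂ (λ x y → q * x + (1ℚ - q) * y)
      (𝔼-cong (F≗G ∘ (inside ∷_))) (𝔼-cong (F≗G ∘ (outside ∷_)))

    𝔼-0 : ∀ n → 𝔼 {n} (λ _ → 0ℚ) ≡ 0ℚ
    𝔼-0 zero    = refl
    𝔼-0 (suc n) = trans (cong (λ x → q * x + (1ℚ - q) * x) (𝔼-0 n))
      (solve 1 (λ q → q :* con 0ℚ :+ (con 1ℚ :- q) :* con 0ℚ := con 0ℚ) refl q)

    𝔼-+ : ∀ {n} (F G : Subset n → ℚ) → 𝔼 (λ M → F M + G M) ≡ 𝔼 F + 𝔼 G
    𝔼-+ {zero}  F G = refl
    𝔼-+ {suc n} F G = trans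
      (cong₂ (λ x y → q * x + (1ℚ - q) * y) (𝔼-+ (F ∘ (inside ∷_)) (G ∘ (inside ∷_)))
                                             (𝔼-+ (F ∘ (outside ∷_)) (G ∘ (outside ∷_))))
      (solve 5 (λ q a b c d → q :* (a :+ b) :+ (con 1ℚ :- q) :* (c :+ d)
                           := (q :* a :+ (con 1ℚ :- q) :* c) :+ (q :* b :+ (con 1ℚ :- q) :* d)) refl
         q (𝔼 (F ∘ (inside ∷_))) (𝔼 (G ∘ (inside ∷_))) (𝔼 (F ∘ (outside ∷_))) (𝔼 (G ∘ (outside ∷_))))

    𝔼-− : ∀ {n} (F G : Subset n → ℚ) → 𝔼 (λ M → F M - G M) ≡ 𝔼 F - 𝔼 G
    𝔼-− F G = trans (move (𝔼 F-G) (𝔼 G)) (cong (_- 𝔼 G) (trans (sym (𝔼-+ F-G G)) (𝔼-cong back)))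
      where
      F-G = λ M → F M - G M
      move : ∀ x y → x ≡ x + y - y
      move = solve 2 (λ x y → x := x :+ y :- y) refl
      back : ∀ M → F-G M + G M ≡ F M
      back M = solve 2 (λ x y → x :- y :+ y := x) refl (F M) (G M)

    -- The expectation is a convex combination over the two choices for the first element, so the
    -- better branch is at least as large; recursion picks every coordinate this way.
    𝔼-attained : ∀ {n} (F : Subset n → ℚ) → ∃[ M ] (𝔼 F ≤ F M)
    𝔼-attained {zero}  F = [] , ℚₚ.≤-refl
    𝔼-attained {suc n} F with 𝔼-attained (F ∘ (inside ∷_)) | 𝔼-attained (F ∘ (outside ∷_))
    ... | M₁ , le₁ | M₀ , le₀ = choose (ℚₚ.≤-total (F (outside ∷ M₀)) (F (inside ∷ M₁)))
      where
      mix : ∀ {x y z} → x ≤ z → y ≤ z → q * x + (1ℚ - q) * y ≤ z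
      mix {x} {y} {z} x≤z y≤z = ℚₚ.≤-trans
        (ℚₚ.+-mono-≤ (*-monoʳ 0≤q x≤z) (*-monoʳ (p≤q⇒0≤q-p q≤1) y≤z))
        (ℚₚ.≤-reflexive (solve 2 (λ q z → q :* z :+ (con 1ℚ :- q) :* z := z) refl q z))
      choose : _ → _
      choose (inj₁ ≤₁) = inside ∷ M₁ , mix le₁ (ℚₚ.≤-trans le₀ ≤₁)
      choose (inj₂ ≤₀) = outside ∷ M₀ , mix (ℚₚ.≤-trans le₁ ≤₀) le₀

    -- C(∣M∩S∣, j) counts the j-subsets of S contained in M, each of which occurs with probability q^j.
    𝔼-C : ∀ {n} (S : Subset n) j → 𝔼 (λ M → ι (∣ M ∩ S ∣ C j)) ≡ ι (∣ S ∣ C j) * q ^ j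
    𝔼-C [] zero    = refl
    𝔼-C [] (suc j) = sym (ℚₚ.*-zeroˡ (q ^ suc j))
    𝔼-C (outside ∷ S) j = trans
      (cong₂ (λ x y → q * x + (1ℚ - q) * y)
        (𝔼-C S j) (𝔼-C S j))
      (solve 2 (λ q z → q :* z :+ (con 1ℚ :- q) :* z := z) refl q (ι (∣ S ∣ C j) * q ^ j))
    𝔼-C (inside ∷ S) zero = trans
      (cong₂ (λ x y → q * x + (1ℚ - q) * y) (𝔼-C S 0) (𝔼-C S 0))
      (solve 2 (λ q z → q :* z :+ (con 1ℚ :- q) :* z := z) refl q (ι (∣ S ∣ C 0) * q ^ 0))
    𝔼-C (inside ∷ S) (suc j) = begin
      q * 𝔼 (λ M → ι (suc ∣ M ∩ S ∣ C suc j)) + (1ℚ - q) * 𝔼 (λ M → ι (∣ M ∩ S ∣ C suc j))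
        ≡⟨ cong₂ (λ x y → q * x + (1ℚ - q) * y)
             (trans (𝔼-cong λ M → ι-pascal ∣ M ∩ S ∣)
               (trans (𝔼-+ (λ M → ι (∣ M ∩ S ∣ C j)) (λ M → ι (∣ M ∩ S ∣ C suc j)))
                      (cong₂ _+_ (𝔼-C S j) (𝔼-C S (suc j)))))
             (𝔼-C S (suc j)) ⟩
      q * (a * q ^ j + b * (q * q ^ j)) + (1ℚ - q) * (b * (q * q ^ j))
        ≡⟨ solve 4 (λ q a b x → q :* (a :* x :+ b :* (q :* x)) :+ (con 1ℚ :- q) :* (b :* (q :* x))
                              := (a :+ b) :* (q :* x)) refl q a b (q ^ j) ⟩
      (a + b) * q ^ suc j
        ≡⟨ cong (_* q ^ suc j) (sym (ι-pascal ∣ S ∣)) ⟩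
      ι (suc ∣ S ∣ C suc j) * q ^ suc j ∎
      where
      open ≡-Reasoning
      a = ι (∣ S ∣ C j)
      b = ι (∣ S ∣ C suc j)
      ι-pascal : ∀ m → ι (suc m C suc j) ≡ ι (m C j) + ι (m C suc j)
      ι-pascal m = trans (cong ι (pascal m j)) (ι-homo-+ (m C j) (m C suc j))

    -- The size of `M` is C(∣M ∩ ⊤∣, 1), so this is `𝔼-C` with `j = 1`.
    𝔼-size : ∀ n → 𝔼 {n} (λ M → ι ∣ M ∣) ≡ ι n * q
    𝔼-size n = trans (𝔼-cong {n} λ M → cong ι (sym (trans (nC1≡n ∣ M ∩ ⊤ ∣) (cong ∣_∣ (Subₚ.∩-identityʳ M)))))
      (trans (𝔼-C (⊤ {n}) 1) (cong₂ (λ u v → ι u * v)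
        (trans (nC1≡n ∣ ⊤ {n} ∣) (Subₚ.∣⊤∣≡n n)) (ℚₚ.*-identityʳ q)))

    -- Its terms dominate the excesses `∣ M ∩ S ∣ ∸ k` and have the closed-form expectation given by
    -- `𝔼-C`.
    crowding : ∀ {n} → List (Subset n × ℕ) → Subset n → ℕ
    crowding cs M = sum (List.map (λ (S , k) → ∣ M ∩ S ∣ C suc k) cs)

    𝔼-crowding : ∀ {n} (cs : List (Subset n × ℕ)) {B} →
                 All (λ (S , k) → ι (∣ S ∣ C suc k) * q ^ suc k ≤ B) cs →
                 𝔼 (ι ∘ crowding cs) ≤ ι (length cs) * B
    𝔼-crowding {n} []             {B} [] = ℚₚ.≤-reflexive (trans (𝔼-0 n) (sym (ℚₚ.*-zeroˡ B)))
    𝔼-crowding     ((S , k) ∷ cs) {B} (c≤B ∷ cs≤B) = begin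
      𝔼 (λ M → ι (∣ M ∩ S ∣ C suc k ℕ.+ crowding cs M))
        ≡⟨ trans (𝔼-cong λ M → ι-homo-+ (∣ M ∩ S ∣ C suc k) (crowding cs M))
                 (𝔼-+ (λ M → ι (∣ M ∩ S ∣ C suc k)) (ι ∘ crowding cs)) ⟩
      𝔼 (λ M → ι (∣ M ∩ S ∣ C suc k)) + 𝔼 (ι ∘ crowding cs)
        ≤⟨ ℚₚ.+-mono-≤ (ℚₚ.≤-trans (ℚₚ.≤-reflexive (𝔼-C S (suc k))) c≤B) (𝔼-crowding cs cs≤B) ⟩
      B + ι (length cs) * B
        ≡⟨ solve 2 (λ b x → b :+ x :* b := (con 1ℚ :+ x) :* b) refl B (ι (length cs)) ⟩
      (1ℚ + ι (length cs)) * B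
        ≡⟨ cong (_* B) (sym (ι-homo-+ 1 (length cs))) ⟩
      ι (suc (length cs)) * B ∎
      where open ℚₚ.≤-Reasoning

    -- Some `M` has size minus crowding at least the expected value; `thinAll` then meets all quotas
    -- with at most `crowding cs M` deletions.
    largeSparseSubset : ∀ {n} (cs : List (Subset n × ℕ)) {B} →
      All (λ (S , k) → ι (∣ S ∣ C suc k) * q ^ suc k ≤ B) cs →
      ∃[ M ] (All (λ (S , k) → ∣ M ∩ S ∣ ℕ.≤ k) cs × ι n * q - ι (length cs) * B ≤ ι ∣ M ∣)
    largeSparseSubset {n} cs {B} cs≤B =
      let M , good = 𝔼-attained (λ M → ι ∣ M ∣ - ι (crowding cs M))
          M′ , _ , sparse , large = thinAll cs M
      in M′ , sparse , (begin
        ι n * q - ι (length cs) * B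
          ≤⟨ ℚₚ.+-mono-≤ (ℚₚ.≤-reflexive (sym (𝔼-size n))) (ℚₚ.neg-antimono-≤ (𝔼-crowding cs cs≤B)) ⟩
        𝔼 {n} (λ M → ι ∣ M ∣) - 𝔼 (ι ∘ crowding cs)
          ≡⟨ sym (𝔼-− (λ M → ι ∣ M ∣) (ι ∘ crowding cs)) ⟩
        𝔼 (λ M → ι ∣ M ∣ - ι (crowding cs M))
          ≤⟨ good ⟩
        (ι ∣ M ∣) - ι (crowding cs M)
          ≤⟨ Rat.sub-≤ (subst (ι ∣ M ∣ ≤_) (ι-homo-+ ∣ M′ ∣ (crowding cs M))
               (ι-mono-≤ (ℕₚ.≤-trans large (ℕₚ.+-monoʳ-≤ ∣ M′ ∣ (excess≤crowding M cs))))) ⟩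
        (ι ∣ M′ ∣) ∎)
      where
      open ℚₚ.≤-Reasoning
      excess≤crowding : ∀ M (cs : List (Subset n × ℕ)) →
        sum (List.map (λ (S , k) → ∣ M ∩ S ∣ ℕ.∸ k) cs) ℕ.≤ crowding cs M
      excess≤crowding M []             = ℕ.z≤n
      excess≤crowding M ((S , k) ∷ cs) = ℕₚ.+-mono-≤ (excess≤C ∣ M ∩ S ∣ k) (excess≤crowding M cs)

  -- The bound for a fixed rational probability.

  module _ {q} (0≤q : 0ℚ ≤ q) (4q≤1 : ι 4 * q ≤ 1ℚ) where

    -- Each unit step multiplies the product by at most 4q ≤ 1.
    centralBinomial*q^-antimono : ∀ {k l} → k ℕ.≤ l →
      ι (centralBinomial l) * q ^ l ≤ ι (centralBinomial k) * q ^ k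
    centralBinomial*q^-antimono k≤l = go (ℕₚ.≤⇒≤′ k≤l)
      where
      open ℚₚ.≤-Reasoning
      step : ∀ l → ι (centralBinomial (suc l)) * q ^ suc l ≤ ι (centralBinomial l) * q ^ l
      step l = begin
        ι (centralBinomial (suc l)) * (q * q ^ l)
          ≤⟨ *-monoˡ (0≤p^k (suc l) 0≤q) (ι-mono-≤ (centralBinomial-suc≤ l)) ⟩
        ι (4 ℕ.* centralBinomial l) * (q * q ^ l)
          ≡⟨ cong (_* (q * q ^ l)) (ι-homo-* 4 (centralBinomial l)) ⟩
        (ι 4 * ι (centralBinomial l)) * (q * q ^ l)
          ≡⟨ solve 4 (λ a c q x → (a :* c) :* (q :* x) := (a :* q) :* (c :* x)) refl
               (ι 4) (ι (centralBinomial l)) q (q ^ l) ⟩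
        (ι 4 * q) * (ι (centralBinomial l) * q ^ l)
          ≤⟨ *-monoˡ (0≤p*q (0≤ι (centralBinomial l)) (0≤p^k l 0≤q)) 4q≤1 ⟩
        1ℚ * (ι (centralBinomial l) * q ^ l)
          ≡⟨ ℚₚ.*-identityˡ _ ⟩
        ι (centralBinomial l) * q ^ l ∎
      go : ∀ {k l} → k ℕ.≤′ l → ι (centralBinomial l) * q ^ l ≤ ι (centralBinomial k) * q ^ k
      go ℕ.≤′-refl           = ℚₚ.≤-refl
      go (ℕ.≤′-step {l} k≤l) = ℚₚ.≤-trans (step l) (go k≤l)

    q≤1 : q ≤ 1ℚ
    q≤1 = ℚₚ.≤-trans (subst (_≤ ι 4 * q) (ℚₚ.*-identityˡ q) (*-monoˡ 0≤q (1≤ι-suc 3))) 4q≤1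

    module _ {n} (G : Graph n) {δ} (δ≤deg : ∀ v → δ ℕ.≤ degree G v) where
      open Graph G

      closed? : ∀ v → Decidable (λ x → x ≡ v ⊎ v ~ x)
      closed? v x = (x Finₚ.≟ v) ⊎-dec (v ~? x)

      nbhd : Fin n → Subset n
      nbhd v = subset (closed? v) id

      -- Irreflexivity keeps `v` out of its open neighbourhood, which therefore fits into the closed
      -- one with `v` removed.
      degree<∣nbhd∣ : ∀ v → degree G v ℕ.< ∣ nbhd v ∣
      degree<∣nbhd∣ v = ℕₚ.≤-<-trans
        (subst (ℕ._≤ ∣ nbhd v ∖ v ∣) (sym (length-filter (v ~?_) id)) (Subₚ.p⊆q⇒∣p∣≤∣q∣ open⊆closed))
        (Subₚ.x∈p⇒∣p-x∣<∣p∣ (∈-subset⁺ (closed? v) (inj₁ refl)))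
        where
        open⊆closed : subset (v ~?_) id ⊆ nbhd v ∖ v
        open⊆closed x∈ = let v~x = ∈-subset⁻ (v ~?_) x∈ in
          Subₚ.x∈p∧x≢y⇒x∈p-y (∈-subset⁺ (closed? v) (inj₂ v~x)) λ x≡v → ~-irrefl (sym x≡v) v~x

      -- This is half the degree, rounded down. Written through `nbhd`, it is tied to `δ` by the
      -- inequality `degree<∣nbhd∣` alone.
      quota : Fin n → ℕ
      quota v = ⌊ pred ∣ nbhd v ∣ /2⌋

      suc-pred-∣nbhd∣ : ∀ v → suc (pred ∣ nbhd v ∣) ≡ ∣ nbhd v ∣
      suc-pred-∣nbhd∣ v = ℕₚ.suc-pred ∣ nbhd v ∣ {{ℕ.>-nonZero (ℕₚ.≤-<-trans ℕ.z≤n (degree<∣nbhd∣ v))}}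

      -- The sum over the closed neighbourhood is its size N minus twice the number of -1's, and
      -- 2⌊(N-1)/2⌋ + 1 ≤ N.
      withinQuota⇒dominating : ∀ M → (∀ v → ∣ M ∩ nbhd v ∣ ℕ.≤ quota v) → IsSignedDomination G (minusOn M)
      withinQuota⇒dominating M within v = ℤ-+-cancelʳ-≤ (+ (2 ℕ.* ∣ M ∩ nbhd v ∣))
        (subst (+ suc (2 ℕ.* ∣ M ∩ nbhd v ∣) ℤ.≤_) (sym (∑-minusOn-id (closed? v) M)) (ℤ.+≤+ (begin
          suc (2 ℕ.* ∣ M ∩ nbhd v ∣)     ≤⟨ ℕ.s≤s (ℕₚ.*-monoʳ-≤ 2 (within v)) ⟩
          suc (2 ℕ.* quota v)            ≤⟨ ℕ.s≤s (2*⌊n/2⌋≤n (pred ∣ nbhd v ∣)) ⟩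
          suc (pred ∣ nbhd v ∣)          ≡⟨ suc-pred-∣nbhd∣ v ⟩
          ∣ nbhd v ∣                     ∎)))
        where open ℕₚ.≤-Reasoning

      private
        B = ι (centralBinomial (suc ⌊ δ /2⌋)) * q ^ suc ⌊ δ /2⌋

      -- First the neighbourhood size is raised to 2(`quota v` + 1), giving a central binomial
      -- coefficient; then antitonicity lowers the index to ⌊δ/2⌋ + 1, since `δ` is at most the
      -- degree.
      crowding≤ : ∀ v → ι (∣ nbhd v ∣ C suc (quota v)) * q ^ suc (quota v) ≤ B
      crowding≤ v = ℚₚ.≤-trans
        (*-monoˡ (0≤p^k (suc (quota v)) 0≤q) (ι-mono-≤ (C-monoˡ-≤ (suc (quota v))
          (subst (ℕ._≤ 2 ℕ.* suc (quota v)) (suc-pred-∣nbhd∣ v) (n<2*suc⌊n/2⌋ (pred ∣ nbhd v ∣))))))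
        (centralBinomial*q^-antimono (ℕ.s≤s (ℕₚ.⌊n/2⌋-mono
          (ℕₚ.≤-trans (δ≤deg v) (ℕₚ.pred-mono-≤ (degree<∣nbhd∣ v))))))

      γₛ≤ : γₛ G / 1 ≤ ι n - ι 2 * (ι n * q - ι n * B)
      γₛ≤ =
        let M , sparse , large = Random.largeSparseSubset q 0≤q q≤1
              (List.map (λ v → nbhd v , quota v) (allFin n))
              (Allₚ.map⁺ (All.universal crowding≤ (allFin n)))
            _ , minimal = γₛ-isSignedDominationNumber G
            γ≤ = minimal (minusOn M) (withinQuota⇒dominating M λ v →
                   All.lookup (Allₚ.map⁻ sparse) (∈ₚ.∈-allFin v))
            large′ = subst (λ l → ι n * q - ι l * B ≤ ι ∣ M ∣)
              (trans (Listₚ.length-map _ (allFin n)) (Listₚ.length-tabulate {n = n} id)) large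
        in begin
          γₛ G / 1
            ≤⟨ /1-mono-≤ γ≤ ⟩
          weight (minusOn M) / 1
            ≡⟨ solve 2 (λ w c → w := (w :+ c) :- c) refl (weight (minusOn M) / 1) (ι (2 ℕ.* ∣ M ∣)) ⟩
          weight (minusOn M) / 1 + ι (2 ℕ.* ∣ M ∣) - ι (2 ℕ.* ∣ M ∣)
            ≡⟨ cong₂ _-_ (trans (sym (/1-homo-+ (weight (minusOn M)) (+ (2 ℕ.* ∣ M ∣))))
                                (cong (_/ 1) (weight-minusOn M)))
                         (ι-homo-* 2 ∣ M ∣) ⟩
          ι n - ι 2 * (ι ∣ M ∣)
            ≤⟨ ℚₚ.+-monoʳ-≤ (ι n) (ℚₚ.neg-antimono-≤ (*-monoʳ (0≤ι 2) large′)) ⟩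
          ι n - ι 2 * (ι n * q - ι n * B) ∎
        where open ℚₚ.≤-Reasoning

  -- Rational approximations of roots and reciprocals.

  1^k≡1 : ∀ k → 1ℚ ^ k ≡ 1ℚ
  1^k≡1 zero    = refl
  1^k≡1 (suc k) = trans (ℚₚ.*-identityˡ (1ℚ ^ k)) (1^k≡1 k)

  /-*-cancel : ∀ n m → (+ n) / suc m * ι (suc m) ≡ ι n
  /-*-cancel n m = ℚₚ.toℚᵘ-injective (begin
    toℚᵘ ((+ n) / suc m * ι (suc m))
      ≈⟨ ℚₚ.toℚᵘ-homo-* ((+ n) / suc m) (ι (suc m)) ⟩
    toℚᵘ ((+ n) / suc m) ℚᵘ.* toℚᵘ (ι (suc m))
      ≈⟨ ℚᵘₚ.*-cong (ℚₚ.toℚᵘ-fromℚᵘ (ℚᵘ.mkℚᵘ (+ n) m)) (ℚₚ.toℚᵘ-fromℚᵘ (ℚᵘ.mkℚᵘ (+ suc m) 0)) ⟩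
    ℚᵘ.mkℚᵘ (+ n) m ℚᵘ.* ℚᵘ.mkℚᵘ (+ suc m) 0
      ≈⟨ ℚᵘ.*≡* (trans (ℤₚ.*-assoc (+ n) (+ suc m) (+ 1))
           (cong (λ z → + n ℤ.* z) (sym (ℤₚ.pos-* (suc m) 1)))) ⟩
    ℚᵘ.mkℚᵘ (+ n) 0
      ≈⟨ ℚᵘₚ.≃-sym (ℚₚ.toℚᵘ-fromℚᵘ (ℚᵘ.mkℚᵘ (+ n) 0)) ⟩
    toℚᵘ (ι n) ∎)
    where open import Relation.Binary.Reasoning.Setoid ℚᵘₚ.≃-setoid

  -- The `m`-th term of `root q a`, hence a lower approximation of a^(1/q) with error below 1/(m+1).
  rootApprox : ℕ → ℕ → ℕ → ℚ
  rootApprox q a m = (+ iroot q (a ℕ.* suc m ℕ.^ q)) / suc m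

  -- Adding 1/(m + 1) makes the lower approximation of a^(1/q) an upper one, and the probability is rounded down.
  rootApprox-upper : ∀ q .{{_ : NonZero q}} a m →
    ∃[ u ] ((rootApprox q a m + (+ 1) / suc m) * ι (suc m) ≡ ι (suc u) ×
            a ℕ.* suc m ℕ.^ q ℕ.≤ suc u ℕ.^ q)
  rootApprox-upper q a m = u ,
    trans (cong (_* ι (suc m)) (trans (ℚₚ.+-comm ((+ u) / suc m) ((+ 1) / suc m)) (sym (Rat./-suc u m))))
          (/-*-cancel (suc u) m) ,
    ℕₚ.<⇒≤ (iroot-upper q (a ℕ.* suc m ℕ.^ q))
    where u = iroot q (a ℕ.* suc m ℕ.^ q)

  1≤rootApprox : ∀ q .{{_ : NonZero q}} a .{{_ : NonZero a}} m → 1ℚ ≤ rootApprox q a m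
  -- The positivity witness stored in `root` is the constant 1, valid from index 0.
  1≤rootApprox q a m = proj₂ (proj₂ (proj₂ (ℝ⁺.positive (root q a)))) m ℕ.z≤n

  -- `_^ʳ_` matches on `mkℚ`, so it is stuck on exponents such as 1/k. Supplying the normal form as
  -- an equation lets `refl` unblock it.
  seq-^ʳ : ∀ b .{{_ : NonZero b}} p k .(c : Coprime.Coprime p (suc k)) r → r ≡ mkℚ (+ p) k c →
           ∀ m → seq (value (b ^ʳ r)) m ≡ rootApprox (suc k) (b ℕ.^ p) m
  seq-^ʳ b p k c r refl m = refl

  1/-normal : ∀ k → (+ 1) / suc k ≡ mkℚ (+ 1) k (Coprime.1-coprimeTo (suc k))
  1/-normal k = ℚₚ.↥p/↧p≡p (mkℚ (+ 1) k (Coprime.1-coprimeTo (suc k)))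

  -- With K = `suc k` the exponent is (K+1)/K, already in lowest terms because consecutive integers
  -- are coprime. Hence the K-th root is taken of the power K + 1.
  1+1/-normal : ∀ k → 1ℚ + (+ 1) / suc k ≡ mkℚ (+ (suc k ℕ.+ 1)) k (Coprime.coprime-+ (Coprime.1-coprimeTo (suc k)))
  1+1/-normal k = begin
    1ℚ + (+ 1) / suc k
      ≡⟨ cong (λ p → 1ℚ + p) (1/-normal k) ⟩
    1ℚ + mkℚ (+ 1) k (Coprime.1-coprimeTo (suc k))
      ≡⟨⟩
    (+ 1 ℤ.* + suc k ℤ.+ + 1 ℤ.* + 1) / (1 ℕ.* suc k)
      ≡⟨ ℚₚ./-cong {+ 1 ℤ.* + suc k ℤ.+ + 1 ℤ.* + 1} {1 ℕ.* suc k} {+ (suc k ℕ.+ 1)} {suc k}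
           (cong (ℤ._+ (+ 1)) (ℤₚ.*-identityˡ (+ suc k))) (ℕₚ.*-identityˡ (suc k)) ⟩
    (+ (suc k ℕ.+ 1)) / suc k
      ≡⟨ ℚₚ.↥p/↧p≡p (mkℚ (+ (suc k ℕ.+ 1)) k (Coprime.coprime-+ (Coprime.1-coprimeTo (suc k)))) ⟩
    mkℚ (+ (suc k ℕ.+ 1)) k (Coprime.coprime-+ (Coprime.1-coprimeTo (suc k))) ∎
    where open ≡-Reasoning

  seq-^ʳ-1/ : ∀ b .{{_ : NonZero b}} k .{{_ : NonZero k}} m →
              seq (value (b ^ʳ ((+ 1) / k))) m ≡ rootApprox k (b ℕ.^ 1) m
  seq-^ʳ-1/ b (suc k) = seq-^ʳ b 1 k (Coprime.1-coprimeTo (suc k)) ((+ 1) / suc k) (1/-normal k)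

  seq-^ʳ-1+1/ : ∀ b .{{_ : NonZero b}} k .{{_ : NonZero k}} m →
                seq (value (b ^ʳ (1ℚ + (+ 1) / k))) m ≡ rootApprox k (b ℕ.^ (k ℕ.+ 1)) m
  seq-^ʳ-1+1/ b (suc k) = seq-^ʳ b (suc k ℕ.+ 1) k (Coprime.coprime-+ (Coprime.1-coprimeTo (suc k)))
    (1ℚ + (+ 1) / suc k) (1+1/-normal k)

  -- Turns integer inequalities into conditions on the probability a/(b+1): the optimality
  -- condition, and 4q ≤ 1 by way of exponent 1.
  ratio-bound : ∀ c a b k → c ℕ.* a ℕ.^ k ℕ.≤ suc b ℕ.^ k → ι c * (ι a * Rat.inv (ι (suc b))) ^ k ≤ 1ℚ
  ratio-bound c a b k le = begin
    ι c * (ι a * i) ^ k           ≡⟨ cong (ι c *_) (^-distrib-* (ι a) i k) ⟩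
    ι c * (ι a ^ k * i ^ k)       ≡⟨ sym (ℚₚ.*-assoc (ι c) (ι a ^ k) (i ^ k)) ⟩
    ι c * ι a ^ k * i ^ k         ≡⟨ cong (_* i ^ k) (sym (trans (ι-homo-* c (a ℕ.^ k)) (cong (ι c *_) (ι-homo-^ a k)))) ⟩
    ι (c ℕ.* a ℕ.^ k) * i ^ k     ≤⟨ *-monoˡ (0≤p^k k (ℚₚ.<⇒≤ (Rat.inv-pos (0<ι-suc b)))) (ι-mono-≤ le) ⟩
    ι (suc b ℕ.^ k) * i ^ k       ≡⟨ cong (_* i ^ k) (ι-homo-^ (suc b) k) ⟩
    ι (suc b) ^ k * i ^ k         ≡⟨ sym (^-distrib-* (ι (suc b)) i k) ⟩
    (ι (suc b) * i) ^ k           ≡⟨ cong (_^ k) (Rat.inv-inverse (0<ι-suc b)) ⟩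
    1ℚ ^ k                        ≡⟨ 1^k≡1 k ⟩
    1ℚ                            ∎
    where
    open ℚₚ.≤-Reasoning
    i = Rat.inv (ι (suc b))

  -- The two reciprocals differ by inv (x y) t ((x + e)(y + e) − x y), where (x + e)(y + e) − x y = e (x + e) + e y.
  inv-perturb : ∀ {x y e t} → 1ℚ ≤ x → 1ℚ ≤ y → 0ℚ ≤ e → 0ℚ ≤ t → t * ((x + e) * (y + e)) ≡ 1ℚ →
                Rat.inv (x * y) ≤ t + ι 2 * e
  inv-perturb {x} {y} {e} {t} 1≤x 1≤y 0≤e 0≤t t-inv = begin
    i
      ≡⟨ sym (ℚₚ.*-identityʳ i) ⟩
    i * 1ℚ
      ≡⟨ cong (i *_) (sym t-inv) ⟩
    i * (t * (X * Y))
      ≡⟨ solve 5 (λ i t x y e → i :* (t :* ((x :+ e) :* (y :+ e)))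
           := t :* (x :* y :* i) :+ ((t :* (x :+ e)) :* i :+ t :* (i :* y)) :* e) refl i t x y e ⟩
    t * (x * y * i) + ((t * X) * i + t * (i * y)) * e
      ≤⟨ ℚₚ.+-mono-≤ (ℚₚ.≤-reflexive (trans (cong (t *_) xyi≡1) (ℚₚ.*-identityʳ t)))
           (*-monoˡ 0≤e (ℚₚ.+-mono-≤ (Rat.*-mono 0≤tX (ℚₚ.<⇒≤ 0<1) tX≤1 i≤1)
                                      (Rat.*-mono 0≤t (ℚₚ.<⇒≤ 0<1) t≤1 iy≤1))) ⟩
    t + ι 2 * e ∎
    where
    open ℚₚ.≤-Reasoning
    X = x + e
    Y = y + e
    i = Rat.inv (x * y)
    0≤1 = ℚₚ.<⇒≤ 0<1
    0<x = ℚₚ.<-≤-trans 0<1 1≤x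
    0<y = ℚₚ.<-≤-trans 0<1 1≤y
    0<xy : 0ℚ < x * y
    0<xy = Rat.*-pos 0<x 0<y
    xyi≡1 : x * y * i ≡ 1ℚ
    xyi≡1 = Rat.inv-inverse 0<xy
    0≤i : 0ℚ ≤ i
    0≤i = ℚₚ.<⇒≤ (Rat.inv-pos 0<xy)
    1≤z+e : ∀ {z} → 1ℚ ≤ z → 1ℚ ≤ z + e
    1≤z+e {z} 1≤z = ℚₚ.≤-trans 1≤z (subst (_≤ z + e) (ℚₚ.+-identityʳ z) (ℚₚ.+-monoʳ-≤ z 0≤e))
    p≤p*z : ∀ {p z} → 0ℚ ≤ p → 1ℚ ≤ z → p ≤ p * z
    p≤p*z {p} {z} 0≤p 1≤z = subst (_≤ p * z) (ℚₚ.*-identityʳ p) (*-monoʳ 0≤p 1≤z)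
    0≤tX : 0ℚ ≤ t * X
    0≤tX = 0≤p*q 0≤t (ℚₚ.≤-trans 0≤1 (1≤z+e 1≤x))
    tX≤1 : t * X ≤ 1ℚ
    tX≤1 = ℚₚ.≤-trans (p≤p*z 0≤tX (1≤z+e 1≤y)) (ℚₚ.≤-reflexive (trans (ℚₚ.*-assoc t X Y) t-inv))
    t≤1 : t ≤ 1ℚ
    t≤1 = ℚₚ.≤-trans (p≤p*z 0≤t (1≤z+e 1≤x)) tX≤1
    iy≤1 : i * y ≤ 1ℚ
    iy≤1 = ℚₚ.≤-trans (p≤p*z (0≤p*q 0≤i (ℚₚ.<⇒≤ 0<y)) 1≤x)
      (ℚₚ.≤-reflexive (trans (solve 3 (λ i x y → i :* y :* x := x :* y :* i) refl i x y) xyi≡1))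
    i≤1 : i ≤ 1ℚ
    i≤1 = ℚₚ.≤-trans (p≤p*z 0≤i 1≤y) iy≤1

  -- Choice of the probability and passage to the limit.

  module _ {n} (G : Graph n) {δ} (δ≤deg : ∀ v → δ ℕ.≤ degree G v) .{{_ : NonZero ⌊ δ /2⌋}} where

    private
      k = ⌊ δ /2⌋
      d = d̃₀·₅ δ
      instance
        d≢0 : NonZero d
        d≢0 = d̃₀·₅≢0 δ

    -- The probability q = (1 + k) z is optimal when (1 + k) d qᵏ = 1.
    γₛ≤-optimised : ∀ z → 0ℚ ≤ z → ι 4 * (ι (suc k) * z) ≤ 1ℚ → ι (suc k ℕ.* d) * (ι (suc k) * z) ^ k ≤ 1ℚ →
                    γₛ G / 1 ≤ (1ℚ - ι (2 ℕ.* k) * z) * ι n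
    γₛ≤-optimised z 0≤z 4q≤1 opt = begin
      γₛ G / 1
        ≤⟨ subst (λ d → γₛ G / 1 ≤ ι n - ι 2 * (ι n * q - ι n * (ι d * q ^ suc k)))
             (sym (d̃≡centralBinomial δ)) (γₛ≤ 0≤q 4q≤1 G δ≤deg) ⟩
      ι n - ι 2 * (ι n * q - ι n * (ι d * q ^ suc k))
        ≤⟨ ℚₚ.+-monoʳ-≤ (ι n) (ℚₚ.neg-antimono-≤ (*-monoʳ (0≤ι 2)
             (ℚₚ.+-monoʳ-≤ (ι n * q) (ℚₚ.neg-antimono-≤ (*-monoʳ (0≤ι n) loss≤z))))) ⟩
      ι n - ι 2 * (ι n * q - ι n * z)
        ≡⟨ cong (λ x → ι n - ι 2 * (ι n * (x * z) - ι n * z)) (ι-homo-+ 1 k) ⟩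
      ι n - ι 2 * (ι n * ((1ℚ + ι k) * z) - ι n * z)
        ≡⟨ solve 4 (λ n k z t → n :- t :* (n :* ((con 1ℚ :+ k) :* z) :- n :* z)
             := (con 1ℚ :- t :* k :* z) :* n) refl (ι n) (ι k) z (ι 2) ⟩
      (1ℚ - ι 2 * ι k * z) * ι n
        ≡⟨ cong (λ x → (1ℚ - x * z) * ι n) (sym (ι-homo-* 2 k)) ⟩
      (1ℚ - ι (2 ℕ.* k) * z) * ι n ∎
      where
      open ℚₚ.≤-Reasoning
      q = ι (suc k) * z
      0≤q = 0≤p*q (0≤ι (suc k)) 0≤z
      -- One factor of `q` is (1+k) z and the rest is controlled by `opt`. The net gain q - z is
      -- then k z, which yields the coefficient 2k.
      loss≤z : ι d * q ^ suc k ≤ z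
      loss≤z = begin
        ι d * (ι (suc k) * z * q ^ k)
          ≡⟨ solve 4 (λ d s z x → d :* (s :* z :* x) := s :* d :* x :* z) refl (ι d) (ι (suc k)) z (q ^ k) ⟩
        ι (suc k) * ι d * q ^ k * z
          ≡⟨ cong (λ x → x * q ^ k * z) (sym (ι-homo-* (suc k) d)) ⟩
        ι (suc k ℕ.* d) * q ^ k * z
          ≤⟨ *-monoˡ 0≤z opt ⟩
        1ℚ * z
          ≡⟨ ℚₚ.*-identityˡ z ⟩
        z ∎

    private
      instance
        base≢0 : NonZero (suc k ℕ.^ (k ℕ.+ 1))
        base≢0 = ℕₚ.m^n≢0 (suc k) (k ℕ.+ 1)
        d^1≢0 : NonZero (d ℕ.^ 1)
        d^1≢0 = ℕₚ.m^n≢0 d 1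

    -- With e = 1/(m+1), both `x + e` and `y + e` are upper approximations of the roots, so z =
    -- 1/((x+e)(y+e)) gives a probability no larger than the optimum. `inv-perturb` then returns to
    -- the lower approximations `x` and `y` at a cost linear in `e`.
    γₛ≤-approx : ∀ m → let x = rootApprox k (suc k ℕ.^ (k ℕ.+ 1)) m
                           y = rootApprox k (d ℕ.^ 1) m in
      γₛ G / 1 ≤ (1ℚ - ι (2 ℕ.* k) * Rat.inv (x * y)) * ι n + ι (4 ℕ.* k ℕ.* n) * ((+ 1) / suc m)
    γₛ≤-approx m = begin
      γₛ G / 1
        ≤⟨ γₛ≤-optimised z 0≤z 4q≤1 opt ⟩
      (1ℚ - ι (2 ℕ.* k) * z) * ι n
        ≤⟨ *-monoˡ (0≤ι n) (ℚₚ.+-monoʳ-≤ 1ℚ (ℚₚ.neg-antimono-≤ (*-monoʳ (0≤ι (2 ℕ.* k))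
             (Rat.sub-≤ (inv-perturb (1≤rootApprox k (suc k ℕ.^ (k ℕ.+ 1)) m) (1≤rootApprox k (d ℕ.^ 1) m) 0≤e 0≤z z-inv))))) ⟩
      (1ℚ - ι (2 ℕ.* k) * (i - ι 2 * e)) * ι n
        ≡⟨ solve 5 (λ c i t e n → (con 1ℚ :- c :* (i :- t :* e)) :* n
             := (con 1ℚ :- c :* i) :* n :+ t :* c :* n :* e) refl (ι (2 ℕ.* k)) i (ι 2) e (ι n) ⟩
      (1ℚ - ι (2 ℕ.* k) * i) * ι n + ι 2 * ι (2 ℕ.* k) * ι n * e
        ≡⟨ cong (λ c → (1ℚ - ι (2 ℕ.* k) * i) * ι n + c * e) (begin-equality
             ι 2 * ι (2 ℕ.* k) * ι n  ≡⟨ cong (_* ι n) (sym (ι-homo-* 2 (2 ℕ.* k))) ⟩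
             ι (2 ℕ.* (2 ℕ.* k)) * ι n ≡⟨ sym (ι-homo-* (2 ℕ.* (2 ℕ.* k)) n) ⟩
             ι (2 ℕ.* (2 ℕ.* k) ℕ.* n) ≡⟨ cong (λ c → ι (c ℕ.* n)) (sym (ℕₚ.*-assoc 2 2 k)) ⟩
             ι (4 ℕ.* k ℕ.* n) ∎) ⟩
      (1ℚ - ι (2 ℕ.* k) * i) * ι n + ι (4 ℕ.* k ℕ.* n) * e ∎
      where
      open ℚₚ.≤-Reasoning
      x = rootApprox k (suc k ℕ.^ (k ℕ.+ 1)) m
      y = rootApprox k (d ℕ.^ 1) m
      i = Rat.inv (x * y)
      e = (+ 1) / suc m
      0≤e : 0ℚ ≤ e
      0≤e = Rat./-≤ 0 1 0 m ℕ.z≤n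
      ux = rootApprox-upper k (suc k ℕ.^ (k ℕ.+ 1)) m
      uy = rootApprox-upper k (d ℕ.^ 1) m
      u = proj₁ ux
      w = proj₁ uy
      -- Chosen so that `suc b` is `suc u * suc w` by computation; the probability becomes a/(b+1).
      b = w ℕ.+ u ℕ.* suc w
      a = suc k ℕ.* (suc m ℕ.* suc m)
      j = Rat.inv (ι (suc b))
      z = ι (suc m ℕ.* suc m) * j
      0≤z : 0ℚ ≤ z
      0≤z = 0≤p*q (0≤ι (suc m ℕ.* suc m)) (ℚₚ.<⇒≤ (Rat.inv-pos (0<ι-suc b)))

      q≡ : ι a * j ≡ ι (suc k) * z
      q≡ = trans (cong (_* j) (ι-homo-* (suc k) (suc m ℕ.* suc m))) (ℚₚ.*-assoc (ι (suc k)) _ j)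

      z-inv : z * ((x + e) * (y + e)) ≡ 1ℚ
      z-inv = begin-equality
        ι (suc m ℕ.* suc m) * j * ((x + e) * (y + e))
          ≡⟨ cong (λ M → M * j * ((x + e) * (y + e))) (ι-homo-* (suc m) (suc m)) ⟩
        ι (suc m) * ι (suc m) * j * ((x + e) * (y + e))
          ≡⟨ solve 4 (λ M j X Y → M :* M :* j :* (X :* Y) := (X :* M) :* (Y :* M) :* j) refl
               (ι (suc m)) j (x + e) (y + e) ⟩
        (x + e) * ι (suc m) * ((y + e) * ι (suc m)) * j
          ≡⟨ cong₂ (λ U W → U * W * j) (proj₁ (proj₂ ux)) (proj₁ (proj₂ uy)) ⟩
        ι (suc u) * ι (suc w) * j
          ≡⟨ cong (_* j) (sym (ι-homo-* (suc u) (suc w))) ⟩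
        ι (suc b) * j
          ≡⟨ Rat.inv-inverse (0<ι-suc b) ⟩
        1ℚ ∎

      -- The condition (1+k) d qᵏ ≤ 1 with denominators cleared. The factors (1+k) and (1+k)ᵏ merge
      -- into (1+k)^(k+1), and the product splits into the two upper root bounds.
      optℕ : suc k ℕ.* d ℕ.* a ℕ.^ k ℕ.≤ suc b ℕ.^ k
      optℕ = ℕ≤.begin
        suc k ℕ.* d ℕ.* a ℕ.^ k
          ℕ≤.≡⟨ cong (suc k ℕ.* d ℕ.*_) (trans (^-ℕ-distribʳ-* k (suc k) (suc m ℕ.* suc m))
                 (cong (suc k ℕ.^ k ℕ.*_) (^-ℕ-distribʳ-* k (suc m) (suc m)))) ⟩
        suc k ℕ.* d ℕ.* (suc k ℕ.^ k ℕ.* (suc m ℕ.^ k ℕ.* suc m ℕ.^ k))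
          ℕ≤.≡⟨ arrange (suc k) d (suc k ℕ.^ k) (suc m ℕ.^ k) ⟩
        (suc k ℕ.^ k ℕ.* (suc k ℕ.* 1)) ℕ.* suc m ℕ.^ k ℕ.* (d ℕ.* 1 ℕ.* suc m ℕ.^ k)
          ℕ≤.≡⟨ cong (λ c → c ℕ.* suc m ℕ.^ k ℕ.* (d ℕ.^ 1 ℕ.* suc m ℕ.^ k))
                 (sym (ℕₚ.^-distribˡ-+-* (suc k) k 1)) ⟩
        suc k ℕ.^ (k ℕ.+ 1) ℕ.* suc m ℕ.^ k ℕ.* (d ℕ.^ 1 ℕ.* suc m ℕ.^ k)
          ℕ≤.≤⟨ ℕₚ.*-mono-≤ (proj₂ (proj₂ ux)) (proj₂ (proj₂ uy)) ⟩
        suc u ℕ.^ k ℕ.* suc w ℕ.^ k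
          ℕ≤.≡⟨ sym (^-ℕ-distribʳ-* k (suc u) (suc w)) ⟩
        suc b ℕ.^ k ℕ≤.∎
        where
        module ℕ≤ = ℕₚ.≤-Reasoning
        arrange : ∀ s d p m → s ℕ.* d ℕ.* (p ℕ.* (m ℕ.* m)) ≡ (p ℕ.* (s ℕ.* 1)) ℕ.* m ℕ.* (d ℕ.* 1 ℕ.* m)
        arrange = solve-∀

      -- Comparing k-th powers: 4ᵏ ≤ (1+k) d, so `optℕ` bounds (4a)ᵏ.
      4a≤b : 4 ℕ.* a ℕ.≤ suc b
      4a≤b = ^-ℕ-cancelʳ-≤ k (ℕₚ.≤-trans (ℕₚ.≤-reflexive (^-ℕ-distribʳ-* k 4 a))
        (ℕₚ.≤-trans (ℕₚ.*-monoˡ-≤ (a ℕ.^ k)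
          (subst (λ d → 4 ℕ.^ k ℕ.≤ suc k ℕ.* d) (sym (d̃≡centralBinomial δ)) (4^k≤[1+k]*centralBinomial k)))
          optℕ))

      opt : ι (suc k ℕ.* d) * (ι (suc k) * z) ^ k ≤ 1ℚ
      opt = subst (λ q → ι (suc k ℕ.* d) * q ^ k ≤ 1ℚ) q≡ (ratio-bound (suc k ℕ.* d) a b k optℕ)

      4q≤1 : ι 4 * (ι (suc k) * z) ≤ 1ℚ
      4q≤1 = subst (λ q → ι 4 * q ≤ 1ℚ) (trans (ℚₚ.*-identityʳ (ι a * j)) q≡)
        (ratio-bound 4 a b 1 (subst₂ (λ p r → 4 ℕ.* p ℕ.≤ r)
          (sym (ℕₚ.^-identityʳ a)) (sym (ℕₚ.^-identityʳ (suc b))) 4a≤b))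

    -- The error in `γₛ≤-approx` is a fixed multiple of 1/(m+1), hence eventually below any `ε`; the
    -- two approximations are identified with terms of the real powers.
    γₛ-upperBound : fromℤ (γₛ G) ≤ʳ
      (fromℕ 1 -ʳ fromℕ (2 ℕ.* k) ÷ʳ ((suc k) ^ʳ (1ℚ + (+ 1 / k)) *⁺ d ^ʳ (+ 1 / k))) *ʳ fromℕ n
    γₛ-upperBound ε 0<ε =
      let N , 1/N≤ = Rat.archimedean (proj₁ (proj₂ η)) in N , λ m N≤m → begin
        γₛ G / 1
          ≤⟨ γₛ≤-approx m ⟩
        (1ℚ - ι (2 ℕ.* k) * Rat.inv (rootApprox k (suc k ℕ.^ (k ℕ.+ 1)) m * rootApprox k (d ℕ.^ 1) m)) * ι n
          + ι c * ((+ 1) / suc m)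
          ≤⟨ ℚₚ.+-mono-≤
               (ℚₚ.≤-reflexive (cong₂ (λ x y → (1ℚ - ι (2 ℕ.* k) * Rat.inv (x * y)) * ι n)
                 (sym (seq-^ʳ-1+1/ (suc k) k m)) (sym (seq-^ʳ-1/ d k m))))
               (ℚₚ.≤-trans (Rat.*-mono (0≤ι c) (ℚₚ.<⇒≤ (proj₁ (proj₂ η))) (ι-mono-≤ (ℕₚ.n≤1+n c))
                 (ℚₚ.≤-trans (Rat./-≤ 1 1 m N (ℕₚ.*-monoʳ-≤ 1 (ℕ.s≤s N≤m))) 1/N≤))
                 (ℚₚ.≤-reflexive (proj₂ (proj₂ η)))) ⟩
        (1ℚ - ι (2 ℕ.* k) * Rat.inv (seq (value (suc k ^ʳ (1ℚ + (+ 1) / k))) m * seq (value (d ^ʳ ((+ 1) / k))) m)) * ι n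
          + ε ∎
      where
      open ℚₚ.≤-Reasoning
      c = 4 ℕ.* k ℕ.* n
      -- Dividing by `suc c` keeps the divisor positive, as `c` vanishes for n = 0.
      η = Rat.quotient (ι (suc c)) ε (0<ι-suc c) 0<ε

open import Data.Nat using (_+_; _*_; _<_)
open import Data.Rational using (_/_) renaming (_+_ to _+ℚ_)

theorem4 : ∀ {n} (G : Graph n) {δ : ℕ} → IsMinimumDegree G δ → (δ>1 : 1 < δ) →
  let δ̂ = ⌊ δ /2⌋
      d̃ = d̃₀·₅ δ
      instance
        δ̂≢0 : NonZero δ̂
        δ̂≢0 = ⌊δ/2⌋≢0 δ>1
        d̃≢0 : NonZero d̃
        d̃≢0 = d̃₀·₅≢0 δ
  in  fromℤ (γₛ G) ≤ʳ
      (fromℕ 1 -ʳ fromℕ (2 * δ̂) ÷ʳ ((1 + δ̂) ^ʳ (1ℚ +ℚ (+ 1 / δ̂)) *⁺ d̃ ^ʳ (+ 1 / δ̂))) *ʳ fromℕ n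
theorem4 G (_ , δ≤deg) δ>1 = γₛ-upperBound G δ≤deg {{⌊δ/2⌋≢0 δ>1}}
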